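{- In the noiseless model, for any $\varepsilon\in(0,1/18)$ there is a randomized algorithm for PARTITION on $n$ elements with query complexity $O(n)$ and round complexity $4$ which, for all $c$, outputs a partition with zero $c$-weighted error with probability at least $1-e^{ -\Omega(n^{\varepsilon})}$.
   Context: Setting. The input is a set of $n$ elements with an unknown total order, presented in uniformly random order (the elements are a priori indistinguishable). For $i\in\{1,\dots,n\}$ the $i$-th smallest element is denoted $i$. PARTITION (with cutoff the median, $k=n/2$): output a partition of the elements into a set $A$ (accepted, meant to be the elements above the median) and a set $R$ (rejected, meant to be the elements below the median). For a constant $c\ge 0$, the $c$-weighted error of $A\sqcup R$ is $\sum_{i>n/2} I(i\in R)\,|i-n/2|^c+\sum_{i<n/2} I(i\in A)\,|i-n/2|^c$, where $I$ is the indicator function (so zero error means no element above or below the median is misplaced). Algorithms access the order only through pairwise comparison queries. Query complexity is the total number of comparisons; round complexity is the number of adaptive rounds (within a round all queries are chosen before any answer of that round is seen). Noiseless model: every comparison returns the correct answer. Asymptotics are as $n\to\infty$. Probabilities are over the random input order and the algorithm's randomness. -}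

module Defs where

open import Data.Bool using (Bool; true; false; if_then_else_)
open import Data.Fin using (Fin; zero; suc; toℕ)
import Data.Fin as Fin
open import Data.Fin.Permutation using (Permutation′; id; insert; remove; insert-remove; _⟨$⟩ʳ_; _⟨$⟩ˡ_; _≈_)
open import Data.Fin.Subset using (Subset; ∁)
open import Data.Fin.Subset.Properties using (_∈?_)
open import Data.Integer using (ℤ; +_; -[1+_])
open import Data.List using (List; []; _∷_; map; filter; length; allFin; cartesianProduct; cartesianProductWith)
open import Data.List.Membership.Propositional using (_∈_)
open import Data.List.Membership.Propositional.Properties using (∈-cartesianProductWith⁺; ∈-allFin)
open import Data.List.Properties using (length-map; length-++; length-tabulate)
open import Data.List.Relation.Unary.Any using (here)
open import Data.List.Relation.Unary.All using (All; []; _∷_)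
open import Data.List.Relation.Unary.All.Properties using (all-filter)
open import Data.Nat using (ℕ; zero; suc; _!)
import Data.Nat as ℕ
import Data.Nat.Properties as ℕ
open import Data.Product using (Σ; ∃; ∃-syntax; _×_; _,_; proj₁; proj₂)
open import Data.Rational hiding (round)
open import Data.Rational.Properties
open import Data.Sum using (_⊎_; inj₁; inj₂)
open import Data.Vec using (Vec)
import Data.Vec as Vec
open import Function using (_∘_; _⇔_; mk⇔; Equivalence)
open import Relation.Binary.PropositionalEquality
open import Relation.Nullary using (¬_; Dec; yes; no; does; contradiction)
open import Relation.Unary using (Decidable)
open import Algebra.Definitions.RawSemiring +-*-rawSemiring using (_^_)

------------------------------------------------------------------------
-- Real numbers

-- Dedekind reals: lower q means q < x, upper q means x < q.
record ℝ : Set₁ where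
  field
    lower upper     : ℚ → Set
    lower-inhabited : ∃ lower
    upper-inhabited : ∃ upper
    lower-rounded   : ∀ q → lower q ⇔ (∃[ r ] q < r × lower r)
    upper-rounded   : ∀ q → upper q ⇔ (∃[ r ] r < q × upper r)
    disjoint        : ∀ q → ¬ (lower q × upper q)
    located         : ∀ {q r} → q < r → lower q ⊎ upper r

open ℝ public

infix 4 _<ʳ_ _ʳ<_ _≤ʳ_

_<ʳ_ : ℚ → ℝ → Set
q <ʳ x = lower x q

_ʳ<_ : ℝ → ℚ → Set
x ʳ< q = upper x q

_≤ʳ_ : ℚ → ℝ → Set
q ≤ʳ x = ¬ (x ʳ< q)

-- Derived real quantities are given by one half of their Dedekind cut:
-- a LowerCut is the set of rationals below the number, an UpperCut the set of
-- rationals above it.  Either half determines the number.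
LowerCut UpperCut : Set₁
LowerCut = ℚ → Set
UpperCut = ℚ → Set

infix 4 _≐_ _≤ᶜ_

_≐_ : LowerCut → LowerCut → Set
a ≐ b = ∀ x → a x ⇔ b x

_≤ᶜ_ : LowerCut → ℚ → Set
a ≤ᶜ p = ∀ x → a x → x ≤ p

0ᶜ : LowerCut
0ᶜ x = x < 0ℚ

infixl 6 _⊕_

_⊕_ : LowerCut → LowerCut → LowerCut
(a ⊕ b) x = ∃[ y ] ∃[ z ] a y × b z × x < y + z

sumᶜ : {A : Set} → List A → (A → LowerCut) → LowerCut
sumᶜ []       f = 0ᶜ
sumᶜ (i ∷ is) f = f i ⊕ sumᶜ is f

-- For C > 0.
infixl 7 _·_

_·_ : ℚ → LowerCut → LowerCut
(C · a) x = ∃[ y ] a y × x < C * y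

-- x < aʳ for a > 0 and rational r = ±p/q: for x ≥ 0 this is x^q < a^(±p).
_<[_^_] : ℚ → ℚ → ℚ → Set
x <[ a ^ r ] = x < 0ℚ ⊎ root (↥ r)
  where
  root : ℤ → Set
  root (+ p)    = x ^ ↧ₙ r < a ^ p
  root -[1+ p ] = x ^ ↧ₙ r * a ^ suc p < 1ℚ

-- aᶜ for rational a > 0 and real c.  Since t ↦ aᵗ is monotone (increasing if
-- a ≥ 1, decreasing if a ≤ 1) and continuous, aᶜ is the supremum of
-- min(aʳ, aˢ) over rationals r < c < s.
_^ᶜ_ : ℚ → ℝ → LowerCut
(a ^ᶜ c) x = ∃[ r ] ∃[ s ] r <ʳ c × c ʳ< s × x <[ a ^ r ] × x <[ a ^ s ]

expSum : ℚ → ℕ → ℚ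
expSum z zero    = 0ℚ
expSum z (suc k) = expSum z k + z ^ k * ((+ 1 / (k !)) {{k ℕ.!≢0}})

-- e^y for y ≥ 0, as the supremum of the partial sums of the power series at
-- the non-negative rationals z < y (z = 0 if there are none).
exp : LowerCut → LowerCut
exp y x = ∃[ z ] ∃[ k ] y z × x < expSum (0ℚ ⊔ z) k

-- e^(-y) for y ≥ 0, as the reciprocal of e^y: it lies below t iff 1/s < t for
-- some 0 < s < e^y.
exp⁻ : LowerCut → UpperCut
exp⁻ y t = ∃[ s ] 0ℚ < s × exp y s × 1ℚ < s * t

1-_ : UpperCut → LowerCut
(1- u) x = u (1ℚ - x)

------------------------------------------------------------------------
-- Comparison algorithms

-- The n elements are presented as Fin n.  A permutation π is the hidden order:
-- the element presented at position j is the (1 + toℕ (π ⟨$⟩ʳ j))-th smallest.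

Query : ℕ → Set
Query n = Fin n × Fin n

-- Deterministic algorithms with r rounds.  The queries of a round depend only
-- on the answers of the previous rounds; a round may be empty.  The output is
-- the accepted set A; the rejected set R is its complement.
data Algorithm (n : ℕ) : ℕ → Set where
  output : (A : Subset n) → Algorithm n 0
  round  : ∀ {r k} → Vec (Query n) k → (Vec Bool k → Algorithm n r) → Algorithm n (suc r)

answer : ∀ {n} → Permutation′ n → Query n → Bool
answer π (a , b) = does ((π ⟨$⟩ʳ a) Fin.<? (π ⟨$⟩ʳ b))

accepted : ∀ {n r} → Algorithm n r → Permutation′ n → Subset n
accepted (output A)          π = A
accepted (round qs continue) π = accepted (continue (Vec.map (answer π) qs)) π

queries : ∀ {n r} → Algorithm n r → Permutation′ n → ℕ
queries (output A)                  π = 0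
queries (round {k = k} qs continue) π = k ℕ.+ queries (continue (Vec.map (answer π) qs)) π

-- A randomized algorithm draws a uniformly random seed up front.
record RandomizedAlgorithm (n r : ℕ) : Set where
  field
    seeds             : ℕ
    {{seeds-nonZero}} : ℕ.NonZero seeds
    run               : Fin seeds → Algorithm n r

open RandomizedAlgorithm public

-- Every permutation occurs exactly once, up to the pointwise equality of
-- permutations: see permutations-complete and length-permutations.
permutations : (n : ℕ) → List (Permutation′ n)
permutations zero    = id ∷ []
permutations (suc n) = cartesianProductWith (insert zero) (allFin (suc n)) (permutations n)

Pr : ∀ {n r} (alg : RandomizedAlgorithm n r) {E : Permutation′ n × Fin (seeds alg) → Set} →
     Decidable E → ℚ
Pr {n} alg E? =
  (+ length (filter E? (cartesianProduct (permutations n) (allFin (seeds alg)))) / (n ! ℕ.* seeds alg))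
    {{ℕ.m*n≢0 (n !) (seeds alg) {{n ℕ.!≢0}}}}

length-cartesianProductWith : {A B C : Set} (f : A → B → C) (xs : List A) (ys : List B) →
  length (cartesianProductWith f xs ys) ≡ length xs ℕ.* length ys
length-cartesianProductWith f []       ys = refl
length-cartesianProductWith f (x ∷ xs) ys = trans (length-++ (map (f x) ys))
  (cong₂ ℕ._+_ (length-map (f x) ys) (length-cartesianProductWith f xs ys))

length-permutations : ∀ n → length (permutations n) ≡ n !
length-permutations zero    = refl
length-permutations (suc n) = trans
  (length-cartesianProductWith (insert zero) (allFin (suc n)) (permutations n))
  (cong₂ ℕ._*_ (length-tabulate {n = suc n} (λ i → i)) (length-permutations n))

permutations-complete : ∀ {n} (π : Permutation′ n) → ∃[ ρ ] ρ ∈ permutations n × ρ ≈ π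
permutations-complete {zero}  π = id , here refl , λ ()
permutations-complete {suc n} π with permutations-complete (remove zero π)
... | ρ , ρ∈ , ρ≈ =
  insert zero (π ⟨$⟩ʳ zero) ρ ,
  ∈-cartesianProductWith⁺ (insert zero) (∈-allFin _) ρ∈ ,
  λ { zero    → insert-remove zero π zero
    ; (suc j) → trans (cong (Fin.punchIn (π ⟨$⟩ʳ zero)) (ρ≈ j)) (insert-remove zero π (suc j)) }

------------------------------------------------------------------------
-- Weighted error

median : ℕ → ℚ
median n = + n / 2

-- i : Fin n stands for the (1 + toℕ i)-th smallest element.
rank : ∀ {n} → Fin n → ℚ
rank i = + suc (toℕ i) / 1

above? : ∀ {n} → Decidable (λ (i : Fin n) → median n < rank i)
above? {n} i = median n <? rank i

below? : ∀ {n} → Decidable (λ (i : Fin n) → rank i < median n)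
below? {n} i = rank i <? median n

I[_]_ : {P : Set} → Dec P → LowerCut → LowerCut
I[ P? ] a = if does P? then a else 0ᶜ

weight : ∀ {n} → ℝ → Fin n → LowerCut
weight {n} c i = ∣ rank i - median n ∣ ^ᶜ c

-- The position of the element of rank i is π ⟨$⟩ˡ i.
error : ∀ {n} → ℝ → Permutation′ n → Subset n → LowerCut
error {n} c π A =
    sumᶜ (filter above? (allFin n)) (λ i → I[ (π ⟨$⟩ˡ i) ∈? R ] weight c i)
  ⊕ sumᶜ (filter below? (allFin n)) (λ i → I[ (π ⟨$⟩ˡ i) ∈? A ] weight c i)
  where
  R = ∁ A

ZeroError : ∀ {n} → ℝ → Permutation′ n → Subset n → Set
ZeroError c π A = error c π A ≐ 0ᶜ

------------------------------------------------------------------------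
-- Having zero error is decidable, so it is an event with a probability

data Sign (a : LowerCut) : Set where
  isZero : a ≐ 0ᶜ → Sign a
  isPos  : (∀ {x} → x < 0ℚ → a x) → (∃[ x ] 0ℚ < x × a x) → Sign a

sign⇒dec : ∀ {a} → Sign a → Dec (a ≐ 0ᶜ)
sign⇒dec (isZero z)              = yes z
sign⇒dec (isPos _ (x , 0<x , ax)) = no λ z → <-asym 0<x (Equivalence.to (z x) ax)

sign-neg : ∀ {a} → Sign a → ∀ {x} → x < 0ℚ → a x
sign-neg (isZero z)  x<0 = Equivalence.from (z _) x<0
sign-neg (isPos n _) x<0 = n x<0

cancel : ∀ x y → y + (x - y) ≡ x
cancel x y = begin
  y + (x - y)     ≡⟨ +-comm y (x - y) ⟩
  (x - y) + y     ≡⟨ +-assoc x (- y) y ⟩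
  x + (- y + y)   ≡⟨ cong (λ h → x + h) (+-inverseˡ y) ⟩
  x + 0ℚ          ≡⟨ +-identityʳ x ⟩
  x               ∎
  where open ≡-Reasoning

x-y<0 : ∀ {x y} → x < y → x - y < 0ℚ
x-y<0 {x} {y} x<y = subst (x - y <_) (+-inverseʳ y) (+-monoˡ-< (- y) x<y)

split : ∀ {x} → x < 0ℚ → ∃[ y ] ∃[ z ] y < 0ℚ × z < 0ℚ × x < y + z
split {x} x<0 with <-dense x<0
... | y , x<y , y<0 with <-dense (x-y<0 x<y)
... | z , d<z , z<0 = y , z , y<0 , z<0 , subst (_< y + z) (cancel x y) (+-monoʳ-< y d<z)

⊕-neg : ∀ {a b} → Sign a → Sign b → ∀ {x} → x < 0ℚ → (a ⊕ b) x
⊕-neg sa sb x<0 with split x<0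
... | y , z , y<0 , z<0 , x< = y , z , sign-neg sa y<0 , sign-neg sb z<0 , x<

pos⊕ : ∀ {a b} → (∃[ x ] 0ℚ < x × a x) → Sign b → ∃[ x ] 0ℚ < x × (a ⊕ b) x
pos⊕ (p , 0<p , ap) sb with <-dense 0<p
... | d , 0<d , d<p with <-dense 0<d
... | x , 0<x , x<d =
  x , 0<x , p , d - p , ap , sign-neg sb (x-y<0 d<p) , subst (x <_) (sym (cancel d p)) x<d

⊕-swap : ∀ {a b x} → (a ⊕ b) x → (b ⊕ a) x
⊕-swap (y , z , ay , bz , x<) = z , y , bz , ay , subst (_ <_) (+-comm y z) x<

⊕-sign : ∀ {a b} → Sign a → Sign b → Sign (a ⊕ b)
⊕-sign (isZero za) (isZero zb) = isZero λ x → mk⇔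
  (λ { (y , z , ay , bz , x<) →
       <-trans x< (+-mono-< (Equivalence.to (za y) ay) (Equivalence.to (zb z) bz)) })
  (⊕-neg (isZero za) (isZero zb))
⊕-sign sa@(isPos _ p) sb = isPos (⊕-neg sa sb) (pos⊕ p sb)
⊕-sign sa@(isZero _) sb@(isPos _ p) with pos⊕ p sa
... | x , 0<x , s = isPos (⊕-neg sa sb) (x , 0<x , ⊕-swap s)

sum-sign : ∀ {A : Set} {P : A → Set} {f : A → LowerCut} {is} →
           (∀ i → P i → Sign (f i)) → All P is → Sign (sumᶜ is f)
sum-sign s []       = isZero λ _ → mk⇔ (λ p → p) (λ p → p)
sum-sign s (p ∷ ps) = ⊕-sign (s _ p) (sum-sign s ps)

I-sign : ∀ {P : Set} {a} (P? : Dec P) → Sign a → Sign (I[ P? ] a)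
I-sign (yes _) s = s
I-sign (no _)  s = isZero λ _ → mk⇔ (λ p → p) (λ p → p)

^-pos : ∀ {a} → 0ℚ < a → ∀ k → 0ℚ < a ^ k
^-pos {a} 0<a zero    = positive⁻¹ 1ℚ
^-pos {a} 0<a (suc k) =
  positive⁻¹ (a * a ^ k) {{pos*pos⇒pos a {{positive 0<a}} (a ^ k) {{positive (^-pos 0<a k)}}}}

^-≤1 : ∀ {x} → 0ℚ < x → x < 1ℚ → ∀ k → x ^ k ≤ 1ℚ
^-≤1 0<x x<1 zero = ≤-refl
^-≤1 {x} 0<x x<1 (suc k) = ≤-trans
  (*-monoˡ-≤-nonNeg x {{pos⇒nonNeg x {{positive 0<x}}}} (^-≤1 0<x x<1 k))
  (≤-trans (≤-reflexive (*-identityʳ x)) (<⇒≤ x<1))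

^-≤x : ∀ {x} → 0ℚ < x → x < 1ℚ → ∀ k → x ^ suc k ≤ x
^-≤x {x} 0<x x<1 k = ≤-trans
  (*-monoˡ-≤-nonNeg x {{pos⇒nonNeg x {{positive 0<x}}}} (^-≤1 0<x x<1 k))
  (≤-reflexive (*-identityʳ x))

below-power : ∀ {a} → 0ℚ < a → ∀ r →
              ∃[ b ] 0ℚ < b × (∀ {x} → 0ℚ < x → x < 1ℚ → x < b → x <[ a ^ r ])
below-power {a} 0<a (mkℚ (+ p) d-1 _) =
  a ^ p , ^-pos 0<a p , λ 0<x x<1 x<b → inj₂ (≤-<-trans (^-≤x 0<x x<1 d-1) x<b)
below-power {a} 0<a (mkℚ -[1+ p ] d-1 _) =
  1/ b , positive⁻¹ (1/ b) {{1/pos⇒pos b}} , λ {x} 0<x x<1 x<1/b → inj₂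
    (≤-<-trans (*-monoʳ-≤-nonNeg b (^-≤x 0<x x<1 d-1))
               (subst (x * b <_) (*-inverseˡ b) (*-monoˡ-<-pos b x<1/b)))
  where
  b = a ^ suc p
  instance
    b-pos : Positive b
    b-pos = positive (^-pos 0<a (suc p))
    b-nonNeg : NonNegative b
    b-nonNeg = pos⇒nonNeg b
    b-nonZero : NonZero b
    b-nonZero = pos⇒nonZero b

between : ∀ {p q} → 0ℚ < p → 0ℚ < q → ∃[ x ] 0ℚ < x × x < p × x < q
between {p} {q} 0<p 0<q with ≤-total p q
... | inj₁ p≤q with <-dense 0<p
...   | x , 0<x , x<p = x , 0<x , x<p , <-≤-trans x<p p≤q
between {p} {q} 0<p 0<q | inj₂ q≤p with <-dense 0<q
...   | x , 0<x , x<q = x , 0<x , <-≤-trans x<q q≤p , x<q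

^ᶜ-sign : ∀ {a} → 0ℚ < a → ∀ c → Sign (a ^ᶜ c)
^ᶜ-sign {a} 0<a c with lower-inhabited c | upper-inhabited c
... | r , r<c | s , c<s with below-power 0<a r | below-power 0<a s
... | b , 0<b , f | d , 0<d , g with between 0<b 0<d
... | u , 0<u , u<b , u<d with between 0<u (positive⁻¹ 1ℚ)
... | x , 0<x , x<u , x<1 = isPos
  (λ y<0 → r , s , r<c , c<s , inj₁ y<0 , inj₁ y<0)
  (x , 0<x , r , s , r<c , c<s ,
    f 0<x x<1 (<-trans x<u u<b) , g 0<x x<1 (<-trans x<u u<d))

0<∣p-q∣ : ∀ p q → p ≢ q → 0ℚ < ∣ p - q ∣
0<∣p-q∣ p q p≢q = positive⁻¹ ∣ p - q ∣ {{nonNeg∧nonZero⇒pos ∣ p - q ∣ {{∣-∣-nonNeg (p - q)}} {{≢-nonZero λ e →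
  p≢q (trans (sym (cancel p q)) (trans (cong (λ h → q + h) (∣p∣≡0⇒p≡0 (p - q) e)) (+-identityʳ q)))}}}}

zeroError? : ∀ {n} c (π : Permutation′ n) A → Dec (ZeroError c π A)
zeroError? {n} c π A = sign⇒dec (⊕-sign
  (sum-sign (λ i m<i → I-sign ((π ⟨$⟩ˡ i) ∈? ∁ A)
      (^ᶜ-sign (0<∣p-q∣ (rank i) (median n) (<⇒≢ m<i ∘ sym)) c))
    (all-filter above? (allFin n)))
  (sum-sign (λ i i<m → I-sign ((π ⟨$⟩ˡ i) ∈? A)
      (^ᶜ-sign (0<∣p-q∣ (rank i) (median n) (<⇒≢ i<m)) c))
    (all-filter below? (allFin n))))

------------------------------------------------------------------------
-- Query complexity and success probability

QueryComplexityLinear : ∀ {r} → (∀ n → RandomizedAlgorithm n r) → Set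
QueryComplexityLinear alg =
  ∃[ K ] ∃[ N ] ∀ n → N ℕ.≤ n → ∀ π seed → queries (run (alg n) seed) π ℕ.≤ K ℕ.* n

Pr[zeroError] : ∀ {n r} → ℝ → RandomizedAlgorithm n r → ℚ
Pr[zeroError] c alg = Pr alg λ (π , seed) → zeroError? c π (accepted (run alg seed) π)

{-# OPTIONS --safe #-}
module Submission where

-- Let d ≈ n^(1/18) and e = d⁵, and draw about d e² positions independently and
-- uniformly; the failure probability is then bounded for every fixed hidden order.
-- Round 1 compares the first d e positions (the pivots) with the whole sample.  By
-- a Chernoff bound the ranks estimated from it single out two pivots that bracket
-- the median within O(n/e) ranks.  Round 2 compares these two with all elements,
-- which leaves O(n/e) undecided elements and gives the exact rank of the bracket.
-- Round 3 compares the undecided elements with the O(e) undecided ones among the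
-- first e² positions.  These hit both windows of n/d⁹ ranks next to the median, so
-- only O(√n) elements stay undecided, and round 4 compares all pairs of them.
-- Thirteen events can spoil this, each of probability at most 2⁻ᵈ.

-- The exponents balance three budgets. About d e² draws determine ranks up to O(n/e), and about d e
-- pivots are enough to hit a window of that width, so round 1 costs about d² e³. Of t positions
-- kept for round 3, about t/e fall among the O(n/e) undecided elements, which costs about t n/e²;
-- hence t may grow to e². To be hit with failure probability 2⁻ᵈ, a window needs n d/t ranks, and
-- round 4 pays for the square of this number, which asks for t of order d √n. With n ≈ d¹⁸ these
-- two demands meet at t = d¹⁰, so e = d⁵, and round 1 costs about d¹⁷, which n covers with a factor
-- d to spare. Probabilities are quotients of counts over a finite product space. Each tail bound is
-- therefore cleared of denominators and proved as an inequality of the form `count * 2 ^ d ≤ n ^ m`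
-- in ℕ. The exponential function enters only in the final comparison of a power of 2 with the
-- claimed bound, where e^½ ≤ 2 is all that has to be known about it.

module Counting where

  open import Defs using (length-cartesianProductWith)
  open import Data.Bool using (true; false; if_then_else_)
  open import Data.Fin using (Fin)
  open import Data.List using (List; []; _∷_; _++_; map; filter; length; allFin; cartesianProductWith)
  open import Data.List.Properties using (map-++; map-∘; length-tabulate)
  open import Data.List.Membership.Propositional using (_∈_)
  open import Data.List.Relation.Unary.Any using (here; there)
  open import Data.Nat
  open import Data.Nat.Properties
  open import Data.Nat.ListAction using (sum; product)
  open import Data.Nat.ListAction.Properties using (sum-++)
  open import Data.Nat.Tactic.RingSolver using (solve-∀)
  open import Data.Product using (∃-syntax; _×_; _,_)
  open import Data.Vec using (Vec; []; _∷_)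
  open import Function using (_∘_)
  open import Relation.Binary.PropositionalEquality
  open import Relation.Nullary using (¬_; does; yes; no; contradiction)
  open import Relation.Unary using (Decidable)
  open import Relation.Unary.Properties using (_∪?_)

  -- Counting in lists, Markov's inequality and Bernoulli's inequalities.

  count : {A : Set} {P : A → Set} → Decidable P → List A → ℕ
  count P? xs = length (filter P? xs)

  module _ {A : Set} where

    count-mono : {P Q : A → Set} (P? : Decidable P) (Q? : Decidable Q) →
                 ∀ xs → (∀ {x} → x ∈ xs → P x → Q x) → count P? xs ≤ count Q? xs
    count-mono P? Q? [] P⇒Q = z≤n
    count-mono P? Q? (x ∷ xs) P⇒Q with P? x | Q? x
    ... | yes _ | yes _ = s≤s (count-mono P? Q? xs (P⇒Q ∘ there))
    ... | yes p | no ¬q = contradiction (P⇒Q (here refl) p) ¬q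
    ... | no _  | yes _ = m≤n⇒m≤1+n (count-mono P? Q? xs (P⇒Q ∘ there))
    ... | no _  | no _  = count-mono P? Q? xs (P⇒Q ∘ there)

    count-cong : {P Q : A → Set} (P? : Decidable P) (Q? : Decidable Q) →
                 ∀ xs → (∀ {x} → x ∈ xs → P x → Q x) → (∀ {x} → x ∈ xs → Q x → P x) →
                 count P? xs ≡ count Q? xs
    count-cong P? Q? xs P⇒Q Q⇒P = ≤-antisym (count-mono P? Q? xs P⇒Q) (count-mono Q? P? xs Q⇒P)

    count-none : {P : A → Set} (P? : Decidable P) → (∀ x → ¬ P x) → ∀ xs → count P? xs ≡ 0
    count-none P? ¬P []       = refl
    count-none P? ¬P (x ∷ xs) with P? x
    ... | yes p = contradiction p (¬P x)
    ... | no _  = count-none P? ¬P xs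

    count-some : {P : A → Set} (P? : Decidable P) → ∀ xs → count P? xs ≢ 0 → ∃[ x ] x ∈ xs × P x
    count-some P? []       some = contradiction refl some
    count-some P? (x ∷ xs) some with P? x
    ... | yes p = x , here refl , p
    ... | no _  with count-some P? xs some
    ...   | y , y∈ , q = y , there y∈ , q

    count-∪ : {P Q : A → Set} (P? : Decidable P) (Q? : Decidable Q) →
              ∀ xs → count (P? ∪? Q?) xs ≤ count P? xs + count Q? xs
    count-∪ P? Q? [] = z≤n
    count-∪ P? Q? (x ∷ xs) with P? x | Q? x
    ... | yes _ | yes _ = s≤s (≤-trans (count-∪ P? Q? xs) (+-monoʳ-≤ (count P? xs) (n≤1+n _)))
    ... | yes _ | no _  = s≤s (count-∪ P? Q? xs)
    ... | no _  | yes _ = ≤-trans (s≤s (count-∪ P? Q? xs)) (≤-reflexive (sym (+-suc (count P? xs) _)))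
    ... | no _  | no _  = count-∪ P? Q? xs

    count-map : {B : Set} {P : A → Set} (P? : Decidable P) (f : B → A) →
                ∀ xs → count P? (map f xs) ≡ count (P? ∘ f) xs
    count-map P? f [] = refl
    count-map P? f (x ∷ xs) with does (P? (f x))
    ... | true  = cong suc (count-map P? f xs)
    ... | false = count-map P? f xs

    sum-map-*ˡ : ∀ c (f : A → ℕ) xs → sum (map (λ x → c * f x) xs) ≡ c * sum (map f xs)
    sum-map-*ˡ c f []       = sym (*-zeroʳ c)
    sum-map-*ˡ c f (x ∷ xs) = trans (cong (c * f x +_) (sum-map-*ˡ c f xs)) (sym (*-distribˡ-+ c (f x) _))

    sum-map-*ʳ : ∀ c (f : A → ℕ) xs → sum (map (λ x → f x * c) xs) ≡ sum (map f xs) * c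
    sum-map-*ʳ c f []       = refl
    sum-map-*ʳ c f (x ∷ xs) = trans (cong (f x * c +_) (sum-map-*ʳ c f xs)) (sym (*-distribʳ-+ c (f x) _))

    sum-map-1 : (xs : List A) → sum (map (λ _ → 1) xs) ≡ length xs
    sum-map-1 []       = refl
    sum-map-1 (x ∷ xs) = cong suc (sum-map-1 xs)

    sum-map-cong : {f g : A → ℕ} → (∀ x → f x ≡ g x) → ∀ xs → sum (map f xs) ≡ sum (map g xs)
    sum-map-cong f≗g []       = refl
    sum-map-cong f≗g (x ∷ xs) = cong₂ _+_ (f≗g x) (sum-map-cong f≗g xs)

    sum-cartesianProductWith : {B C : Set} (F : C → ℕ) (f : A → B → C) → ∀ xs ys →
      sum (map F (cartesianProductWith f xs ys)) ≡ sum (map (λ x → sum (map (λ y → F (f x y)) ys)) xs)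
    sum-cartesianProductWith F f []       ys = refl
    sum-cartesianProductWith F f (x ∷ xs) ys = begin
      sum (map F (map (f x) ys ++ cartesianProductWith f xs ys))
        ≡⟨ cong sum (map-++ F (map (f x) ys) _) ⟩
      sum (map F (map (f x) ys) ++ map F (cartesianProductWith f xs ys))
        ≡⟨ sum-++ (map F (map (f x) ys)) _ ⟩
      sum (map F (map (f x) ys)) + sum (map F (cartesianProductWith f xs ys))
        ≡⟨ cong₂ _+_ (cong sum (sym (map-∘ ys))) (sum-cartesianProductWith F f xs ys) ⟩
      sum (map (F ∘ f x) ys) + sum (map (λ z → sum (map (λ y → F (f z y)) ys)) xs) ∎
      where open ≡-Reasoning

    markov : {P : A → Set} (P? : Decidable P) (F : A → ℕ) (c : ℕ) →
             (∀ x → P x → c ≤ F x) → ∀ xs → count P? xs * c ≤ sum (map F xs)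
    markov P? F c c≤F [] = z≤n
    markov P? F c c≤F (x ∷ xs) with P? x
    ... | yes p = +-mono-≤ (c≤F x p) (markov P? F c c≤F xs)
    ... | no _  = m≤n⇒m≤o+n (F x) (markov P? F c c≤F xs)

    -- Pivots, sample and cut are prefixes of one random vector, so all events live on one product
    -- space; the union bound asks for no independence between them.
    prefix : ∀ {m} → ℕ → Vec A m → List A
    prefix zero    v       = []
    prefix (suc k) []      = []
    prefix (suc k) (x ∷ v) = x ∷ prefix k v

    length-prefix : ∀ {m} k (v : Vec A m) → k ≤ m → length (prefix k v) ≡ k
    length-prefix zero    v       k≤m       = refl
    length-prefix (suc k) (x ∷ v) (s≤s k≤m) = cong suc (length-prefix k v k≤m)

  -- M and 1 + M stand for the two terms of the ratio β = 1 + 1/M; the Bernoulli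
  -- inequalities 1 + i/M ≤ βⁱ ≤ M/(M − i) then make β a substitute for the
  -- exponential function.
  bernoulli-lower : ∀ M i → M ^ i * (M + i) ≤ suc M ^ i * M
  bernoulli-lower M zero    = ≤-reflexive (cong (λ h → h + 0) (+-identityʳ M))
  bernoulli-lower M (suc i) = begin
    M * M ^ i * (M + suc i)         ≡⟨ solve₁ M (M ^ i) i ⟩
    M ^ i * (M * (M + suc i))       ≤⟨ *-monoʳ-≤ (M ^ i) (m≤m+n _ i) ⟩
    M ^ i * (M * (M + suc i) + i)   ≡⟨ solve₂ M (M ^ i) i ⟩
    suc M * (M ^ i * (M + i))       ≤⟨ *-monoʳ-≤ (suc M) (bernoulli-lower M i) ⟩
    suc M * (suc M ^ i * M)         ≡⟨ *-assoc (suc M) (suc M ^ i) M ⟨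
    suc M * suc M ^ i * M           ∎
    where
    open ≤-Reasoning
    solve₁ : ∀ a b c → a * b * (a + suc c) ≡ b * (a * (a + suc c))
    solve₁ = solve-∀
    solve₂ : ∀ a b c → b * (a * (a + suc c) + c) ≡ suc a * (b * (a + c))
    solve₂ = solve-∀

  bernoulli-upper : ∀ M i a → i + a ≡ M → suc M ^ i * a ≤ M ^ i * M
  bernoulli-upper M zero    a refl = ≤-refl
  bernoulli-upper M (suc i) a refl = begin
    suc M * suc M ^ i * a           ≡⟨ solve₁ (suc M) (suc M ^ i) a ⟩
    suc M ^ i * (suc M * a)         ≤⟨ *-monoʳ-≤ (suc M ^ i) (m≤m+n _ (suc i)) ⟩
    suc M ^ i * (suc M * a + suc i) ≡⟨ solve₂ i a (suc M ^ i) ⟩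
    M * (suc M ^ i * suc a)         ≤⟨ *-monoʳ-≤ M (bernoulli-upper M i (suc a) (+-suc i a)) ⟩
    M * (M ^ i * M)                 ≡⟨ *-assoc M (M ^ i) M ⟨
    M * M ^ i * M                   ∎
    where
    open ≤-Reasoning
    solve₁ : ∀ a b c → a * b * c ≡ b * (a * c)
    solve₁ = solve-∀
    solve₂ : ∀ i a b → b * (suc (suc i + a) * a + suc i) ≡ (suc i + a) * (b * suc a)
    solve₂ = solve-∀

  ^-distribʳ-* : ∀ a b k → (a * b) ^ k ≡ a ^ k * b ^ k
  ^-distribʳ-* a b zero    = refl
  ^-distribʳ-* a b (suc k) = trans (cong (a * b *_) (^-distribʳ-* a b k)) (swap a b (a ^ k) (b ^ k))
    where
    swap : ∀ a b c d → a * b * (c * d) ≡ a * c * (b * d)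
    swap = solve-∀

  -- `bernoulli-lower` at `i = M` gives βᴹ ≥ 2; the rest is taking `d`-th powers.
  double-power : ∀ M d .{{_ : NonZero M}} → 2 ^ d * M ^ (M * d) ≤ suc M ^ (M * d)
  double-power M d = begin
    2 ^ d * M ^ (M * d)   ≡⟨ cong (2 ^ d *_) (^-*-assoc M M d) ⟨
    2 ^ d * (M ^ M) ^ d   ≡⟨ ^-distribʳ-* 2 (M ^ M) d ⟨
    (2 * M ^ M) ^ d       ≤⟨ ^-monoˡ-≤ d (*-cancelʳ-≤ _ _ M step) ⟩
    (suc M ^ M) ^ d       ≡⟨ ^-*-assoc (suc M) M d ⟩
    suc M ^ (M * d)       ∎
    where
    open ≤-Reasoning
    solve₁ : ∀ a b → 2 * b * a ≡ b * (a + a)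
    solve₁ = solve-∀
    step : 2 * M ^ M * M ≤ suc M ^ M * M
    step = ≤-trans (≤-reflexive (solve₁ M (M ^ M))) (bernoulli-lower M M)

  -- The hypothesis reads B ≤ N β⁻ᵃ. Of the `a` factors β, `M * d` give at least 2ᵈ, and the surplus
  -- `z` of them are at least 1. Every tail bound gets its final form here.
  decay : ∀ M a d B N .{{_ : NonZero M}} → M * d ≤ a → B * suc M ^ a ≤ M ^ a * N → B * 2 ^ d ≤ N
  decay M a d B N Md≤a hyp = *-cancelˡ-≤ (M ^ a) {{m^n≢0 M a}} (begin
    M ^ a * (B * 2 ^ d)             ≡⟨ cong (λ h → M ^ h * (B * 2 ^ d)) (m+[n∸m]≡n Md≤a) ⟨
    M ^ (M * d + z) * (B * 2 ^ d)   ≡⟨ cong (_* (B * 2 ^ d)) (^-distribˡ-+-* M (M * d) z) ⟩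
    M ^ (M * d) * M ^ z * (B * 2 ^ d)  ≡⟨ solve₁ (M ^ (M * d)) (M ^ z) B (2 ^ d) ⟩
    B * (2 ^ d * M ^ (M * d) * M ^ z)  ≤⟨ *-monoʳ-≤ B (*-mono-≤ (double-power M d) (^-monoˡ-≤ z (n≤1+n M))) ⟩
    B * (suc M ^ (M * d) * suc M ^ z)  ≡⟨ cong (B *_) (^-distribˡ-+-* (suc M) (M * d) z) ⟨
    B * suc M ^ (M * d + z)         ≡⟨ cong (λ h → B * suc M ^ h) (m+[n∸m]≡n Md≤a) ⟩
    B * suc M ^ a                   ≤⟨ hyp ⟩
    M ^ a * N                       ∎)
    where
    open ≤-Reasoning
    z = a ∸ M * d
    solve₁ : ∀ a b c d → a * b * (c * d) ≡ c * (d * a * b)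
    solve₁ = solve-∀

  -- Tail bounds for independent uniform draws.

  module Sampling (n : ℕ) where

    samples : (m : ℕ) → List (Vec (Fin n) m)
    samples zero    = [] ∷ []
    samples (suc m) = cartesianProductWith _∷_ (allFin n) (samples m)

    length-samples : ∀ m → length (samples m) ≡ n ^ m
    length-samples zero    = refl
    length-samples (suc m) = trans (length-cartesianProductWith _∷_ (allFin n) (samples m))
      (cong₂ _*_ (length-tabulate {n = n} (λ i → i)) (length-samples m))

    prefixWeight : ∀ {m} → (Fin n → ℕ) → ℕ → Vec (Fin n) m → ℕ
    prefixWeight g k v = product (map g (prefix k v))

    -- Independence of the coordinates: the sum factorises, with one factor `sum (map g (allFin n))`
    -- for each of the first `k` coordinates and one factor `n` for each of the others.
    sum-weight : ∀ g k m → k ≤ m →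
      sum (map (prefixWeight g k) (samples m)) ≡ sum (map g (allFin n)) ^ k * n ^ (m ∸ k)
    sum-weight g zero    m       _         =
      trans (sum-map-1 (samples m)) (trans (length-samples m) (sym (+-identityʳ (n ^ m))))
    sum-weight g (suc k) (suc m) (s≤s k≤m) = begin
      sum (map (prefixWeight g (suc k)) (samples (suc m)))
        ≡⟨ sum-cartesianProductWith (prefixWeight g (suc k)) _∷_ (allFin n) (samples m) ⟩
      sum (map (λ x → sum (map (λ v → g x * prefixWeight g k v) (samples m))) (allFin n))
        ≡⟨ sum-map-cong (λ x → sum-map-*ˡ (g x) (prefixWeight g k) (samples m)) (allFin n) ⟩
      sum (map (λ x → g x * sum (map (prefixWeight g k) (samples m))) (allFin n))
        ≡⟨ sum-map-*ʳ _ g (allFin n) ⟩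
      sum (map g (allFin n)) * sum (map (prefixWeight g k) (samples m))
        ≡⟨ cong (sum (map g (allFin n)) *_) (sum-weight g k m k≤m) ⟩
      sum (map g (allFin n)) * (sum (map g (allFin n)) ^ k * n ^ (m ∸ k))
        ≡⟨ *-assoc (sum (map g (allFin n))) _ _ ⟨
      sum (map g (allFin n)) ^ suc k * n ^ (m ∸ k) ∎
      where open ≡-Reasoning

    module _ {Q : Fin n → Set} (Q? : Decidable Q) where

      size : ℕ
      size = count Q? (allFin n)

      hits : ∀ {m} → ℕ → Vec (Fin n) m → ℕ
      hits k v = count Q? (prefix k v)

      -- The exponential tilt of Chernoff's method: weight 1 + 1/e for a hit and 1 for a miss,
      -- scaled by `e` to stay in ℕ.
      tilt : ℕ → Fin n → ℕ
      tilt e x = if does (Q? x) then suc e else e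

      sum-tilt : ∀ e xs → sum (map (tilt e) xs) ≡ e * length xs + count Q? xs
      sum-tilt e [] = sym (trans (+-identityʳ (e * 0)) (*-zeroʳ e))
      sum-tilt e (x ∷ xs) with does (Q? x)
      ... | true  = trans (cong (suc e +_) (sum-tilt e xs)) (solve₁ e (length xs) (count Q? xs))
        where
        solve₁ : ∀ e l c → suc e + (e * l + c) ≡ e * suc l + suc c
        solve₁ = solve-∀
      ... | false = trans (cong (e +_) (sum-tilt e xs)) (solve₁ e (length xs) (count Q? xs))
        where
        solve₁ : ∀ e l c → e + (e * l + c) ≡ e * suc l + c
        solve₁ = solve-∀

      -- Each of `j` hits gains the factor 1 + 1/e over the baseline `e ^ length xs`; the powers
      -- `e ^ j` clear the denominators.
      product-tilt : ∀ e xs j → j ≤ count Q? xs →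
                     suc e ^ j * e ^ length xs ≤ e ^ j * product (map (tilt e) xs)
      product-tilt e [] zero _ = ≤-refl
      product-tilt e (x ∷ xs) j j≤ with does (Q? x)
      -- A hit beyond the required `j`: its weight is only used to be at least `e`.
      product-tilt e (x ∷ xs) zero j≤ | true = begin
        1 * (e * e ^ length xs)              ≡⟨ *-identityˡ _ ⟩
        e * e ^ length xs                    ≤⟨ *-mono-≤ (n≤1+n e) (*-cancelˡ-≤ 1 (product-tilt e xs zero z≤n)) ⟩
        suc e * product (map (tilt e) xs)    ≡⟨ *-identityˡ _ ⟨
        1 * (suc e * product (map (tilt e) xs)) ∎
        where open ≤-Reasoning
      product-tilt e (x ∷ xs) (suc j) (s≤s j≤) | true = begin
        suc e * suc e ^ j * (e * e ^ length xs)             ≡⟨ solve₁ (suc e) (suc e ^ j) e (e ^ length xs) ⟩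
        suc e * e * (suc e ^ j * e ^ length xs)             ≤⟨ *-monoʳ-≤ (suc e * e) (product-tilt e xs j j≤) ⟩
        suc e * e * (e ^ j * product (map (tilt e) xs))     ≡⟨ solve₂ (suc e) e (e ^ j) (product (map (tilt e) xs)) ⟩
        e * e ^ j * (suc e * product (map (tilt e) xs))     ∎
        where
        open ≤-Reasoning
        solve₁ : ∀ a b c d → a * b * (c * d) ≡ a * c * (b * d)
        solve₁ = solve-∀
        solve₂ : ∀ a b c d → a * b * (c * d) ≡ b * c * (a * d)
        solve₂ = solve-∀
      product-tilt e (x ∷ xs) j j≤ | false = begin
        suc e ^ j * (e * e ^ length xs)               ≡⟨ solve₁ (suc e ^ j) e (e ^ length xs) ⟩
        e * (suc e ^ j * e ^ length xs)               ≤⟨ *-monoʳ-≤ e (product-tilt e xs j j≤) ⟩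
        e * (e ^ j * product (map (tilt e) xs))       ≡⟨ solve₁ e (e ^ j) _ ⟩
        e ^ j * (e * product (map (tilt e) xs))       ∎
        where
        open ≤-Reasoning
        solve₁ : ∀ a b c → a * (b * c) ≡ b * (a * c)
        solve₁ = solve-∀

      many? : ∀ {m} k j → Decidable (λ (v : Vec (Fin n) m) → j ≤ hits k v)
      many? k j v = j ≤? hits k v

      none? : ∀ {m} k → Decidable (λ (v : Vec (Fin n) m) → hits k v ≡ 0)
      none? k v = hits k v ≟ 0

      -- Markov's inequality for the tilted product: after division, the probability of at least `j`
      -- hits is at most (1 + size/(e n))ᵏ / (1 + 1/e)ʲ.
      tilt-moment : ∀ e k m j → k ≤ m →
        count (many? k j) (samples m) * (suc e ^ j * e ^ k) ≤ e ^ j * ((e * n + size) ^ k * n ^ (m ∸ k))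
      tilt-moment e k m j k≤m = begin
        count (many? k j) (samples m) * (suc e ^ j * e ^ k)
          ≤⟨ markov (many? k j) (λ v → e ^ j * prefixWeight (tilt e) k v) _ bound (samples m) ⟩
        sum (map (λ v → e ^ j * prefixWeight (tilt e) k v) (samples m))
          ≡⟨ sum-map-*ˡ (e ^ j) (prefixWeight (tilt e) k) (samples m) ⟩
        e ^ j * sum (map (prefixWeight (tilt e) k) (samples m))
          ≡⟨ cong (e ^ j *_) (sum-weight (tilt e) k m k≤m) ⟩
        e ^ j * (sum (map (tilt e) (allFin n)) ^ k * n ^ (m ∸ k))
          ≡⟨ cong (λ h → e ^ j * (h ^ k * n ^ (m ∸ k))) (sum-tilt e (allFin n)) ⟩
        e ^ j * ((e * length (allFin n) + size) ^ k * n ^ (m ∸ k))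
          ≡⟨ cong (λ h → e ^ j * ((e * h + size) ^ k * n ^ (m ∸ k))) (length-tabulate {n = n} (λ i → i)) ⟩
        e ^ j * ((e * n + size) ^ k * n ^ (m ∸ k)) ∎
        where
        open ≤-Reasoning
        bound : ∀ v → j ≤ hits k v → suc e ^ j * e ^ k ≤ e ^ j * prefixWeight (tilt e) k v
        bound v j≤ = subst (λ h → suc e ^ j * e ^ h ≤ e ^ j * prefixWeight (tilt e) k v)
          (length-prefix k v k≤m) (product-tilt e (prefix k v) j j≤)

      split-power : ∀ {k m} → k ≤ m → n ^ k * n ^ (m ∸ k) ≡ n ^ m
      split-power {k} {m} k≤m =
        trans (sym (^-distribˡ-+-* n k (m ∸ k))) (cong (n ^_) (m+[n∸m]≡n k≤m))

      -- With μ = size · k / n, the hypothesis reads (1 + 1/e)(μ + d e) ≤ j.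
      many-rare : ∀ e k m j d → .{{_ : NonZero e}} → .{{_ : NonZero n}} → k ≤ m →
        suc e * (size * k + d * (e * n)) ≤ e * n * j →
        count (many? k j) (samples m) * 2 ^ d ≤ n ^ m
      many-rare e k m j d k≤m hyp =
        decay M y d B (n ^ m) {{M≢0}} Md≤y
          (*-cancelˡ-≤ (e ^ j * e ^ k * (suc M ^ (i * k) * M ^ (i * k)))
            {{m*n≢0 _ _ {{m*n≢0 _ _ {{m^n≢0 e j}} {{m^n≢0 e k}}}} {{m*n≢0 _ _ {{m^n≢0 (suc M) (i * k)}} {{m^n≢0 M (i * k) {{M≢0}}}}}}}}
            (begin
          e ^ j * e ^ k * (suc M ^ (i * k) * M ^ (i * k)) * (B * suc M ^ y)
            ≡⟨ solve₁ (e ^ j) (e ^ k) (suc M ^ (i * k)) (M ^ (i * k)) B (suc M ^ y) ⟩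
          B * e ^ k * M ^ (i * k) * (suc M ^ (i * k) * suc M ^ y * e ^ j)
            ≡⟨ cong (λ h → B * e ^ k * M ^ (i * k) * (h * e ^ j)) (trans (sym (^-distribˡ-+-* (suc M) (i * k) y)) (cong (suc M ^_) split)) ⟩
          B * e ^ k * M ^ (i * k) * (suc M ^ (e * n * j) * e ^ j)
            ≤⟨ *-monoʳ-≤ (B * e ^ k * M ^ (i * k)) inside ⟩
          B * e ^ k * M ^ (i * k) * (M ^ (e * n * j) * suc e ^ j)
            ≡⟨ solve₂ B (e ^ k) (M ^ (i * k)) (M ^ (e * n * j)) (suc e ^ j) ⟩
          M ^ (i * k) * M ^ (e * n * j) * (B * (suc e ^ j * e ^ k))
            ≤⟨ *-monoʳ-≤ (M ^ (i * k) * M ^ (e * n * j)) (tilt-moment e k m j k≤m) ⟩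
          M ^ (i * k) * M ^ (e * n * j) * (e ^ j * ((e * n + size) ^ k * n ^ (m ∸ k)))
            ≡⟨ solve₃ (M ^ (i * k)) (M ^ (e * n * j)) (e ^ j) ((e * n + size) ^ k) (n ^ (m ∸ k)) ⟩
          M ^ (e * n * j) * e ^ j * n ^ (m ∸ k) * (M ^ (i * k) * (e * n + size) ^ k)
            ≤⟨ *-monoʳ-≤ (M ^ (e * n * j) * e ^ j * n ^ (m ∸ k)) outside ⟩
          M ^ (e * n * j) * e ^ j * n ^ (m ∸ k) * (suc M ^ (i * k) * (e ^ k * n ^ k))
            ≡⟨ cong (λ h → h * e ^ j * n ^ (m ∸ k) * (suc M ^ (i * k) * (e ^ k * n ^ k))) (trans (cong (M ^_) (sym split)) (^-distribˡ-+-* M (i * k) y)) ⟩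
          M ^ (i * k) * M ^ y * e ^ j * n ^ (m ∸ k) * (suc M ^ (i * k) * (e ^ k * n ^ k))
            ≡⟨ solve₄ (M ^ (i * k)) (M ^ y) (e ^ j) (n ^ (m ∸ k)) (suc M ^ (i * k)) (e ^ k) (n ^ k) ⟩
          e ^ j * e ^ k * (suc M ^ (i * k) * M ^ (i * k)) * (M ^ y * (n ^ k * n ^ (m ∸ k)))
            ≡⟨ cong (λ h → e ^ j * e ^ k * (suc M ^ (i * k) * M ^ (i * k)) * (M ^ y * h)) (split-power k≤m) ⟩
          e ^ j * e ^ k * (suc M ^ (i * k) * M ^ (i * k)) * (M ^ y * n ^ m) ∎))
        where
        open ≤-Reasoning
        B = count (many? k j) (samples m)
        -- With this `M`, both bases of the moment bound compare with integral powers of β: 1 + 1/e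
        -- ≥ β^(e n) and 1 + size/(e n) ≤ βⁱ. The bound becomes β^(i k - e n j), and the hypothesis
        -- says that e n j - i k ≥ M d.
        M = suc e * (e * n)
        i = suc e * size
        y = e * n * j ∸ i * k
        en≢0 : NonZero (e * n)
        en≢0 = m*n≢0 e n
        M≢0 : NonZero M
        M≢0 = m*n≢0 (suc e) (e * n) {{_}} {{en≢0}}
        solve₀ : ∀ a s k d x → a * s * k + a * x * d ≡ a * (s * k + d * x)
        solve₀ = solve-∀
        total : i * k + M * d ≤ e * n * j
        total = ≤-trans (≤-reflexive (solve₀ (suc e) size k d (e * n))) hyp
        split : i * k + y ≡ e * n * j
        split = m+[n∸m]≡n (m+n≤o⇒m≤o (i * k) total)
        Md≤y : M * d ≤ y
        Md≤y = m+n≤o⇒m≤o∸n (M * d) (≤-trans (≤-reflexive (+-comm (M * d) (i * k))) total)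
        solve₁ : ∀ a b c d e f → a * b * (c * d) * (e * f) ≡ e * b * d * (c * f * a)
        solve₁ = solve-∀
        solve₂ : ∀ a b c d e → a * b * c * (d * e) ≡ c * d * (a * (e * b))
        solve₂ = solve-∀
        solve₃ : ∀ a b c d e → a * b * (c * (d * e)) ≡ b * c * e * (a * d)
        solve₃ = solve-∀
        solve₄ : ∀ a b c d e f g → a * b * c * d * (e * (f * g)) ≡ c * f * (e * a) * (b * (g * d))
        solve₄ = solve-∀
        -- Here M - e n = e (e n), so M / (M - e n) is exactly 1 + 1/e.
        ratio-inside : suc M ^ (e * n) * e ≤ M ^ (e * n) * suc e
        ratio-inside = *-cancelʳ-≤ _ _ (e * n) {{en≢0}} (begin
          suc M ^ (e * n) * e * (e * n)    ≡⟨ *-assoc (suc M ^ (e * n)) e (e * n) ⟩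
          suc M ^ (e * n) * (e * (e * n))  ≤⟨ bernoulli-upper M (e * n) (e * (e * n)) refl ⟩
          M ^ (e * n) * M                  ≡⟨ *-assoc (M ^ (e * n)) (suc e) (e * n) ⟨
          M ^ (e * n) * suc e * (e * n)    ∎)
        inside : suc M ^ (e * n * j) * e ^ j ≤ M ^ (e * n * j) * suc e ^ j
        inside = begin
          suc M ^ (e * n * j) * e ^ j      ≡⟨ cong (_* e ^ j) (^-*-assoc (suc M) (e * n) j) ⟨
          (suc M ^ (e * n)) ^ j * e ^ j    ≡⟨ ^-distribʳ-* (suc M ^ (e * n)) e j ⟨
          (suc M ^ (e * n) * e) ^ j        ≤⟨ ^-monoˡ-≤ j ratio-inside ⟩
          (M ^ (e * n) * suc e) ^ j        ≡⟨ ^-distribʳ-* (M ^ (e * n)) (suc e) j ⟩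
          (M ^ (e * n)) ^ j * suc e ^ j    ≡⟨ cong (_* suc e ^ j) (^-*-assoc M (e * n) j) ⟩
          M ^ (e * n * j) * suc e ^ j      ∎
        ratio-outside : M ^ i * (e * n + size) ≤ suc M ^ i * (e * n)
        ratio-outside = *-cancelˡ-≤ (suc e) (begin
          suc e * (M ^ i * (e * n + size))       ≡⟨ solve₇ (suc e) (M ^ i) (e * n) size ⟩
          M ^ i * (M + i)                        ≤⟨ bernoulli-lower M i ⟩
          suc M ^ i * M                          ≡⟨ solve₈ (suc M ^ i) (suc e) (e * n) ⟩
          suc e * (suc M ^ i * (e * n))          ∎)
          where
          solve₇ : ∀ a b c d → a * (b * (c + d)) ≡ b * (a * c + a * d)
          solve₇ = solve-∀
          solve₈ : ∀ a b c → a * (b * c) ≡ b * (a * c)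
          solve₈ = solve-∀
        outside : M ^ (i * k) * (e * n + size) ^ k ≤ suc M ^ (i * k) * (e ^ k * n ^ k)
        outside = begin
          M ^ (i * k) * (e * n + size) ^ k      ≡⟨ cong (_* (e * n + size) ^ k) (^-*-assoc M i k) ⟨
          (M ^ i) ^ k * (e * n + size) ^ k      ≡⟨ ^-distribʳ-* (M ^ i) (e * n + size) k ⟨
          (M ^ i * (e * n + size)) ^ k          ≤⟨ ^-monoˡ-≤ k ratio-outside ⟩
          (suc M ^ i * (e * n)) ^ k             ≡⟨ ^-distribʳ-* (suc M ^ i) (e * n) k ⟩
          (suc M ^ i) ^ k * (e * n) ^ k         ≡⟨ cong₂ _*_ (^-*-assoc (suc M) i k) (^-distribʳ-* e n k) ⟩
          suc M ^ (i * k) * (e ^ k * n ^ k)     ∎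

      avoid : Fin n → ℕ
      avoid x = if does (Q? x) then 0 else 1

      sum-avoid : ∀ xs → count Q? xs + sum (map avoid xs) ≡ length xs
      sum-avoid [] = refl
      sum-avoid (x ∷ xs) with does (Q? x)
      ... | true  = cong suc (sum-avoid xs)
      ... | false = trans (+-suc _ _) (cong suc (sum-avoid xs))

      product-avoid : ∀ xs → count Q? xs ≡ 0 → 1 ≤ product (map avoid xs)
      product-avoid [] _ = ≤-refl
      product-avoid (x ∷ xs) none with does (Q? x)
      ... | false = ≤-trans (product-avoid xs none) (≤-reflexive (sym (+-identityʳ _)))

      -- The fraction of vectors without a hit is at most (1 - size/n)ᵏ, and 1 - size/n ≤ (1 +
      -- 1/n)^(-size) by `bernoulli-upper`, so `decay` applies with `M = n`.
      none-rare : ∀ k m d → .{{_ : NonZero n}} → k ≤ m → n * d ≤ size * k →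
        count (none? k) (samples m) * 2 ^ d ≤ n ^ m
      none-rare k m d k≤m hyp = decay n (size * k) d B (n ^ m) hyp (begin
        B * suc n ^ (size * k)                        ≡⟨ *-comm B _ ⟩
        suc n ^ (size * k) * B                        ≤⟨ *-monoʳ-≤ (suc n ^ (size * k)) moment ⟩
        suc n ^ (size * k) * (r ^ k * n ^ (m ∸ k))    ≡⟨ *-assoc (suc n ^ (size * k)) _ _ ⟨
        suc n ^ (size * k) * r ^ k * n ^ (m ∸ k)      ≤⟨ *-monoˡ-≤ (n ^ (m ∸ k)) ratio ⟩
        n ^ (size * k) * n ^ k * n ^ (m ∸ k)          ≡⟨ *-assoc (n ^ (size * k)) _ _ ⟩
        n ^ (size * k) * (n ^ k * n ^ (m ∸ k))        ≡⟨ cong (n ^ (size * k) *_) (split-power k≤m) ⟩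
        n ^ (size * k) * n ^ m                        ∎)
        where
        open ≤-Reasoning
        B = count (none? k) (samples m)
        r = sum (map avoid (allFin n))
        moment : B ≤ r ^ k * n ^ (m ∸ k)
        moment = begin
          B                                      ≡⟨ *-identityʳ B ⟨
          B * 1                                  ≤⟨ markov (none? k) (prefixWeight avoid k) 1 (λ v → product-avoid (prefix k v)) (samples m) ⟩
          sum (map (prefixWeight avoid k) (samples m)) ≡⟨ sum-weight avoid k m k≤m ⟩
          r ^ k * n ^ (m ∸ k)                    ∎
        ratio : suc n ^ (size * k) * r ^ k ≤ n ^ (size * k) * n ^ k
        ratio = begin
          suc n ^ (size * k) * r ^ k   ≡⟨ cong (_* r ^ k) (^-*-assoc (suc n) size k) ⟨
          (suc n ^ size) ^ k * r ^ k   ≡⟨ ^-distribʳ-* (suc n ^ size) r k ⟨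
          (suc n ^ size * r) ^ k       ≤⟨ ^-monoˡ-≤ k (bernoulli-upper n size r (trans (sum-avoid (allFin n)) (length-tabulate {n = n} (λ i → i)))) ⟩
          (n ^ size * n) ^ k           ≡⟨ ^-distribʳ-* (n ^ size) n k ⟩
          (n ^ size) ^ k * n ^ k       ≡⟨ cong (_* n ^ k) (^-*-assoc n size k) ⟩
          n ^ (size * k) * n ^ k       ∎

-- Rational arithmetic and comparison of the exponential function with powers of 2.

module Exponential where

  open import Defs
  import Data.Integer as ℤ
  import Data.Integer.Properties as ℤ
  open import Data.Integer using (+_; -[1+_])
  open import Data.Nat using (ℕ; zero; suc; _!)
  import Data.Nat as ℕ
  import Data.Nat.Properties as ℕ
  open import Data.Product using (_,_)
  open import Data.Rational hiding (round)
  open import Data.Rational.Properties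
  open import Algebra.Definitions.RawSemiring +-*-rawSemiring using (_^_)
  open import Data.Rational.Solver using (module +-*-Solver)
  import Data.Rational.Unnormalised as ℚᵘ
  import Data.Rational.Unnormalised.Properties as ℚᵘ
  open import Data.Sum using (inj₁; inj₂)
  open import Function using (Equivalence)
  open import Relation.Binary.Definitions using (tri<; tri≈; tri>)
  open import Relation.Binary.PropositionalEquality
  open import Relation.Nullary using (¬_; yes; no; contradiction)

  mul-≤ˡ : ∀ {a b c} → 0ℚ ≤ a → b ≤ c → a * b ≤ a * c
  mul-≤ˡ {a} 0≤a = *-monoˡ-≤-nonNeg a {{nonNegative 0≤a}}

  mul-≤ʳ : ∀ {a b c} → 0ℚ ≤ a → b ≤ c → b * a ≤ c * a
  mul-≤ʳ {a} 0≤a = *-monoʳ-≤-nonNeg a {{nonNegative 0≤a}}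

  mul-nonNeg : ∀ {a b} → 0ℚ ≤ a → 0ℚ ≤ b → 0ℚ ≤ a * b
  mul-nonNeg {a} {b} 0≤a 0≤b = subst (_≤ a * b) (*-zeroʳ a) (mul-≤ˡ 0≤a 0≤b)

  ^-nonNeg : ∀ {a} → 0ℚ ≤ a → ∀ k → 0ℚ ≤ a ^ k
  ^-nonNeg 0≤a zero    = nonNegative⁻¹ 1ℚ
  ^-nonNeg 0≤a (suc k) = mul-nonNeg 0≤a (^-nonNeg 0≤a k)

  ^-monoˡ : ∀ {a b} → 0ℚ ≤ a → a ≤ b → ∀ k → a ^ k ≤ b ^ k
  ^-monoˡ 0≤a a≤b zero    = ≤-refl
  ^-monoˡ 0≤a a≤b (suc k) =
    ≤-trans (mul-≤ˡ 0≤a (^-monoˡ 0≤a a≤b k)) (mul-≤ʳ (^-nonNeg (≤-trans 0≤a a≤b) k) a≤b)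

  ι : ℕ → ℚ
  ι n = + n / 1

  -- `_/_` cancels common factors and is stuck on variables, so identities about it are checked on
  -- unnormalised fractions.
  toℚᵘ-/ : ∀ n d .{{_ : ℕ.NonZero d}} → toℚᵘ (n / d) ℚᵘ.≃ (n ℚᵘ./ d)
  toℚᵘ-/ n (suc d) = toℚᵘ-fromℚᵘ (ℚᵘ.mkℚᵘ n d)

  ι-+ : ∀ m n → ι (m ℕ.+ n) ≡ ι m + ι n
  ι-+ m n = toℚᵘ-injective (begin
    toℚᵘ (ι (m ℕ.+ n))           ≈⟨ toℚᵘ-/ (+ (m ℕ.+ n)) 1 ⟩
    + (m ℕ.+ n) ℚᵘ./ 1           ≈⟨ ℚᵘ.*≡* (cong (ℤ._* + 1) (cong₂ ℤ._+_ (sym (ℤ.*-identityʳ (+ m))) (sym (ℤ.*-identityʳ (+ n))))) ⟩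
    (+ m ℚᵘ./ 1) ℚᵘ.+ (+ n ℚᵘ./ 1)    ≈⟨ ℚᵘ.+-cong (toℚᵘ-/ (+ m) 1) (toℚᵘ-/ (+ n) 1) ⟨
    toℚᵘ (ι m) ℚᵘ.+ toℚᵘ (ι n)   ≈⟨ toℚᵘ-homo-+ (ι m) (ι n) ⟨
    toℚᵘ (ι m + ι n) ∎)
    where open ℚᵘ.≃-Reasoning

  ι-* : ∀ m n → ι (m ℕ.* n) ≡ ι m * ι n
  ι-* m n = toℚᵘ-injective (begin
    toℚᵘ (ι (m ℕ.* n))           ≈⟨ toℚᵘ-/ (+ (m ℕ.* n)) 1 ⟩
    + (m ℕ.* n) ℚᵘ./ 1           ≈⟨ ℚᵘ.*≡* (cong (ℤ._* + 1) (ℤ.pos-* m n)) ⟩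
    (+ m ℚᵘ./ 1) ℚᵘ.* (+ n ℚᵘ./ 1)    ≈⟨ ℚᵘ.*-cong (toℚᵘ-/ (+ m) 1) (toℚᵘ-/ (+ n) 1) ⟨
    toℚᵘ (ι m) ℚᵘ.* toℚᵘ (ι n)   ≈⟨ toℚᵘ-homo-* (ι m) (ι n) ⟨
    toℚᵘ (ι m * ι n) ∎)
    where open ℚᵘ.≃-Reasoning

  /-*-ι : ∀ n d .{{_ : ℕ.NonZero d}} → (+ n / d) * ι d ≡ ι n
  /-*-ι n d@(suc _) = toℚᵘ-injective (begin
    toℚᵘ ((+ n / d) * ι d)               ≈⟨ toℚᵘ-homo-* (+ n / d) (ι d) ⟩
    toℚᵘ (+ n / d) ℚᵘ.* toℚᵘ (ι d)       ≈⟨ ℚᵘ.*-cong (toℚᵘ-/ (+ n) d) (toℚᵘ-/ (+ d) 1) ⟩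
    (+ n ℚᵘ./ d) ℚᵘ.* (+ d ℚᵘ./ 1)       ≈⟨ ℚᵘ.*≡* (trans (ℤ.*-identityʳ (+ n ℤ.* + d)) (cong (+ n ℤ.*_) (cong +_ (sym (ℕ.*-identityʳ d))))) ⟩
    + n ℚᵘ./ 1                           ≈⟨ toℚᵘ-/ (+ n) 1 ⟨
    toℚᵘ (ι n)                           ∎)
    where open ℚᵘ.≃-Reasoning

  ι-mono : ∀ {m n} → m ℕ.≤ n → ι m ≤ ι n
  ι-mono {m} {n} m≤n = toℚᵘ-cancel-≤ (begin
    toℚᵘ (ι m)   ≃⟨ toℚᵘ-/ (+ m) 1 ⟩
    + m ℚᵘ./ 1   ≤⟨ ℚᵘ.*≤* (ℤ.*-monoʳ-≤-nonNeg (+ 1) (ℤ.+≤+ m≤n)) ⟩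
    + n ℚᵘ./ 1   ≃⟨ toℚᵘ-/ (+ n) 1 ⟨
    toℚᵘ (ι n)   ∎)
    where open ℚᵘ.≤-Reasoning

  ι-nonNeg : ∀ n → 0ℚ ≤ ι n
  ι-nonNeg n = ι-mono {0} {n} ℕ.z≤n

  ι-pos : ∀ n .{{_ : ℕ.NonZero n}} → 0ℚ < ι n
  ι-pos (suc n) = <-≤-trans (positive⁻¹ 1ℚ) (ι-mono {1} {suc n} (ℕ.s≤s ℕ.z≤n))

  ι-^ : ∀ m k → ι (m ℕ.^ k) ≡ ι m ^ k
  ι-^ m zero    = refl
  ι-^ m (suc k) = trans (ι-* m (m ℕ.^ k)) (cong (ι m *_) (ι-^ m k))

  coeff : ℕ → ℚ
  coeff k = (+ 1 / (k !)) {{k ℕ.!≢0}}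

  coeff-suc : ∀ k → coeff k ≡ ι (suc k) * coeff (suc k)
  coeff-suc k = begin
    coeff k                                          ≡⟨ *-identityʳ (coeff k) ⟨
    coeff k * 1ℚ                                     ≡⟨ cong (coeff k *_) (/-*-ι 1 (suc k !) {{suc k ℕ.!≢0}}) ⟨
    coeff k * (coeff (suc k) * ι (suc k ℕ.* k !))    ≡⟨ cong (λ h → coeff k * (coeff (suc k) * h)) (ι-* (suc k) (k !)) ⟩
    coeff k * (coeff (suc k) * (ι (suc k) * ι (k !)))
      ≡⟨ solve 4 (λ a b c d → a :* (b :* (c :* d)) := c :* b :* (a :* d)) refl (coeff k) (coeff (suc k)) (ι (suc k)) (ι (k !)) ⟩
    ι (suc k) * coeff (suc k) * (coeff k * ι (k !))  ≡⟨ cong (ι (suc k) * coeff (suc k) *_) (/-*-ι 1 (k !) {{k ℕ.!≢0}}) ⟩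
    ι (suc k) * coeff (suc k) * 1ℚ                   ≡⟨ *-identityʳ _ ⟩
    ι (suc k) * coeff (suc k)                        ∎
    where
    open ≡-Reasoning
    open +-*-Solver

  coeff-nonNeg : ∀ k → 0ℚ ≤ coeff k
  coeff-nonNeg k = nonNegative⁻¹ (coeff k) {{normalize-nonNeg 1 (k !) {{k ℕ.!≢0}}}}

  term-nonNeg : ∀ {z} → 0ℚ ≤ z → ∀ k → 0ℚ ≤ z ^ k * coeff k
  term-nonNeg 0≤z k = mul-nonNeg (^-nonNeg 0≤z k) (coeff-nonNeg k)

  expSum-suc-≤ : ∀ {z} → 0ℚ ≤ z → ∀ k → expSum z k ≤ expSum z (suc k)
  expSum-suc-≤ {z} 0≤z k = subst (_≤ expSum z (suc k)) (+-identityʳ (expSum z k))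
    (+-monoʳ-≤ (expSum z k) (term-nonNeg 0≤z k))

  expSum-mono : ∀ {z x} → 0ℚ ≤ z → z ≤ x → ∀ k → expSum z k ≤ expSum x k
  expSum-mono 0≤z z≤x zero    = ≤-refl
  expSum-mono 0≤z z≤x (suc k) =
    +-mono-≤ (expSum-mono 0≤z z≤x k) (mul-≤ʳ (coeff-nonNeg k) (^-monoˡ 0≤z z≤x k))

  module _ {z h : ℚ} (0≤z : 0ℚ ≤ z) (0≤h : 0ℚ ≤ h) where

    private
      x = z + h
      z≤x : z ≤ x
      z≤x = subst (_≤ x) (+-identityʳ z) (+-monoʳ-≤ z 0≤h)
      0≤x : 0ℚ ≤ x
      0≤x = ≤-trans 0≤z z≤x

    -- The mean value inequality for a power on [z, x], where the derivative is largest at x.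
    power-increment : ∀ k → x ^ suc k ≤ z ^ suc k + ι (suc k) * (h * x ^ k)
    power-increment zero = ≤-reflexive
      (solve 2 (λ z h → (z :+ h) :* con 1ℚ := z :* con 1ℚ :+ con 1ℚ :* (h :* con 1ℚ)) refl z h)
      where open +-*-Solver
    power-increment (suc k) = begin
      x * x ^ suc k
        ≤⟨ mul-≤ˡ 0≤x (power-increment k) ⟩
      x * (z ^ suc k + ι (suc k) * (h * x ^ k))
        ≡⟨ solve 5 (λ z h zk i xk → (z :+ h) :* (zk :+ i :* (h :* xk)) := z :* zk :+ i :* (h :* ((z :+ h) :* xk)) :+ h :* zk) refl z h (z ^ suc k) (ι (suc k)) (x ^ k) ⟩
      z * z ^ suc k + ι (suc k) * (h * x ^ suc k) + h * z ^ suc k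
        ≤⟨ +-monoʳ-≤ (z * z ^ suc k + ι (suc k) * (h * x ^ suc k)) (mul-≤ˡ 0≤h (^-monoˡ 0≤z z≤x (suc k))) ⟩
      z * z ^ suc k + ι (suc k) * (h * x ^ suc k) + h * x ^ suc k
        ≡⟨ solve 3 (λ a i b → a :+ i :* b :+ b := a :+ (con 1ℚ :+ i) :* b) refl (z * z ^ suc k) (ι (suc k)) (h * x ^ suc k) ⟩
      z * z ^ suc k + (ι 1 + ι (suc k)) * (h * x ^ suc k)
        ≡⟨ cong (λ i → z * z ^ suc k + i * (h * x ^ suc k)) (ι-+ 1 (suc k)) ⟨
      z ^ suc (suc k) + ι (suc (suc k)) * (h * x ^ suc k) ∎
      where
      open ≤-Reasoning
      open +-*-Solver

    term-increment : ∀ k → x ^ suc k * coeff (suc k) ≤ z ^ suc k * coeff (suc k) + h * (x ^ k * coeff k)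
    term-increment k = begin
      x ^ suc k * c                                    ≤⟨ mul-≤ʳ (coeff-nonNeg (suc k)) (power-increment k) ⟩
      (z ^ suc k + ι (suc k) * (h * x ^ k)) * c        ≡⟨ solve 5 (λ a i h b c → (a :+ i :* (h :* b)) :* c := a :* c :+ h :* (b :* (i :* c))) refl (z ^ suc k) (ι (suc k)) h (x ^ k) c ⟩
      z ^ suc k * c + h * (x ^ k * (ι (suc k) * c))    ≡⟨ cong (λ y → z ^ suc k * c + h * (x ^ k * y)) (coeff-suc k) ⟨
      z ^ suc k * c + h * (x ^ k * coeff k)            ∎
      where
      open ≤-Reasoning
      open +-*-Solver
      c = coeff (suc k)

    -- A discrete form of (eᶻ)′ = eᶻ.
    expSum-increment : ∀ k → expSum x (suc k) ≤ expSum z (suc k) + h * expSum x k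
    expSum-increment zero    = ≤-reflexive (sym (trans (cong (λ y → expSum z 1 + y) (*-zeroʳ h)) (+-identityʳ (expSum z 1))))
    expSum-increment (suc k) = begin
      expSum x (suc k) + x ^ suc k * coeff (suc k)
        ≤⟨ +-mono-≤ (expSum-increment k) (term-increment k) ⟩
      (expSum z (suc k) + h * expSum x k) + (z ^ suc k * coeff (suc k) + h * (x ^ k * coeff k))
        ≡⟨ solve 5 (λ a h b c d → (a :+ h :* b) :+ (c :+ h :* d) := (a :+ c) :+ h :* (b :+ d)) refl (expSum z (suc k)) h (expSum x k) (z ^ suc k * coeff (suc k)) (x ^ k * coeff k) ⟩
      (expSum z (suc k) + z ^ suc k * coeff (suc k)) + h * (expSum x k + x ^ k * coeff k) ∎
      where
      open ≤-Reasoning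
      open +-*-Solver

  0≤½ : 0ℚ ≤ ½
  0≤½ = nonNegative⁻¹ ½

  -- The increment with `h = ½` bounds the left side E by F + ½ E, where F is the sum with one more
  -- term at z; solving for E gives 2 F. This is e^½ ≤ 2 at the level of partial sums.
  expSum-½ : ∀ {z} → 0ℚ ≤ z → ∀ k → expSum (z + ½) k ≤ ι 2 * expSum z (suc k)
  expSum-½ {z} 0≤z k = begin
    E                          ≡⟨ solve 1 (λ a → a := con (ι 2) :* (a :+ con (- ½) :* a)) refl E ⟩
    ι 2 * (E + - ½ * E)        ≤⟨ mul-≤ˡ (ι-nonNeg 2) (+-monoˡ-≤ (- ½ * E) (≤-trans (expSum-suc-≤ 0≤x k) (expSum-increment 0≤z 0≤½ k))) ⟩
    ι 2 * ((F + ½ * E) + - ½ * E) ≡⟨ solve 2 (λ a b → con (ι 2) :* ((b :+ con ½ :* a) :+ con (- ½) :* a) := con (ι 2) :* b) refl E F ⟩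
    ι 2 * F                    ∎
    where
    open ≤-Reasoning
    open +-*-Solver
    E = expSum (z + ½) k
    F = expSum z (suc k)
    0≤x : 0ℚ ≤ z + ½
    0≤x = +-mono-≤ 0≤z 0≤½

  expSum-0 : ∀ k → expSum 0ℚ (suc k) ≡ 1ℚ
  expSum-0 zero    = refl
  expSum-0 (suc k) = trans (cong₂ _+_ (expSum-0 k)
    (trans (cong (_* coeff (suc k)) (*-zeroˡ (0ℚ ^ k))) (*-zeroˡ (coeff (suc k))))) (+-identityʳ 1ℚ)

  -- `L` applications of e^½ ≤ 2. Each of them lengthens the partial sum by a term, so the induction
  -- is on `L` for all `k` at once.
  expSum-halves : ∀ L k → expSum (ι L * ½) k ≤ ι (2 ℕ.^ L)
  expSum-halves zero    k = ≤-trans (expSum-suc-≤ ≤-refl k) (≤-reflexive (expSum-0 k))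
  expSum-halves (suc L) k = begin
    expSum (ι (suc L) * ½) k         ≡⟨ cong (λ y → expSum y k) split½ ⟩
    expSum (ι L * ½ + ½) k           ≤⟨ expSum-½ (mul-nonNeg (ι-nonNeg L) 0≤½) k ⟩
    ι 2 * expSum (ι L * ½) (suc k)   ≤⟨ mul-≤ˡ (ι-nonNeg 2) (expSum-halves L (suc k)) ⟩
    ι 2 * ι (2 ℕ.^ L)                ≡⟨ ι-* 2 (2 ℕ.^ L) ⟨
    ι (2 ℕ.^ suc L)                  ∎
    where
    open ≤-Reasoning
    split½ : ι (suc L) * ½ ≡ ι L * ½ + ½
    split½ = trans (cong (_* ½) (ι-+ 1 L))
      (solve 1 (λ l → (con 1ℚ :+ l) :* con ½ := l :* con ½ :+ con ½) refl (ι L))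
      where open +-*-Solver

  <ʳ-ʳ<-trans : ∀ x {q r} → q <ʳ x → x ʳ< r → q < r
  <ʳ-ʳ<-trans x {q} {r} q<x x<r with <-cmp q r
  ... | tri< q<r _ _  = q<r
  ... | tri≈ _ refl _ = contradiction (q<x , x<r) (disjoint x q)
  ... | tri> _ _ r<q  = contradiction (Equivalence.from (lower-rounded x r) (q , r<q , q<x) , x<r) (disjoint x r)

  numerator-< : ∀ r {p} → ↥ r ≡ + p → r < + 1 / 18 → p ℕ.* 18 ℕ.< ↧ₙ r
  numerator-< r {p} ↥r≡p (*<* lt) = ℤ.drop‿+<+ (subst₂ ℤ._<_
    (trans (cong (ℤ._* + 18) ↥r≡p) (sym (ℤ.pos-* p 18))) (ℤ.*-identityˡ (↧ r)) lt)

  -- Membership of y in the cut comes with a rational r = p/q < ε for which y < nʳ. As 18 p < q, the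
  -- assumption y ≥ d would give y^q ≥ d^(18 p) ≥ n^p. For negative r, y ≥ 1 and n ≥ 1 contradict nʳ
  -- > y directly.
  power-< : ∀ {ε n d y} .{{_ : ℕ.NonZero n}} .{{_ : ℕ.NonZero d}} → ε ʳ< (+ 1 / 18) → n ℕ.≤ d ℕ.^ 18 →
            (ι n ^ᶜ ε) y → y < ι d
  power-< {ε} {n} {d} {y} ε< n≤d¹⁸ (r , s , r<ε , ε<s , y<nʳ , _) with y <? ι d
  ... | yes y<d = y<d
  ... | no  y≮d = contradiction y<nʳ (absurd r (<ʳ-ʳ<-trans ε r<ε ε<))
    where
    d≤y : ι d ≤ y
    d≤y = ≮⇒≥ y≮d
    1≤d : 1 ℕ.≤ d
    1≤d = ℕ.>-nonZero⁻¹ d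
    1≤y : 1ℚ ≤ y
    1≤y = ≤-trans (ι-mono {1} {d} 1≤d) d≤y
    y≮0 : ¬ y < 0ℚ
    y≮0 y<0 = <-irrefl refl (<-trans (<-≤-trans (positive⁻¹ 1ℚ) 1≤y) y<0)
    1≤^ : ∀ {a} → 1ℚ ≤ a → ∀ k → 1ℚ ≤ a ^ k
    1≤^ 1≤a zero = ≤-refl
    1≤^ {a} 1≤a (suc k) = ≤-trans (1≤^ 1≤a k)
      (subst (_≤ a * a ^ k) (*-identityˡ (a ^ k)) (mul-≤ʳ (^-nonNeg (≤-trans (nonNegative⁻¹ 1ℚ) 1≤a) k) 1≤a))
    absurd : ∀ r → r < + 1 / 18 → ¬ (y <[ ι n ^ r ])
    absurd r _ (inj₁ y<0) = y≮0 y<0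
    absurd r@(mkℚ (+ p) q-1 _) r< (inj₂ lt) = <-irrefl refl (begin-strict
      y ^ suc q-1          <⟨ lt ⟩
      ι n ^ p              ≡⟨ ι-^ n p ⟨
      ι (n ℕ.^ p)          ≤⟨ ι-mono {n ℕ.^ p} {d ℕ.^ suc q-1} powers ⟩
      ι (d ℕ.^ suc q-1)    ≡⟨ ι-^ d (suc q-1) ⟩
      ι d ^ suc q-1        ≤⟨ ^-monoˡ (ι-nonNeg d) d≤y (suc q-1) ⟩
      y ^ suc q-1          ∎)
      where
      open ≤-Reasoning
      powers : n ℕ.^ p ℕ.≤ d ℕ.^ suc q-1
      powers = ℕ.≤-trans (ℕ.^-monoˡ-≤ p n≤d¹⁸) (ℕ.≤-trans (ℕ.≤-reflexive (ℕ.^-*-assoc d 18 p))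
        (ℕ.^-monoʳ-≤ d (ℕ.≤-trans (ℕ.≤-reflexive (ℕ.*-comm 18 p)) (ℕ.<⇒≤ (numerator-< r refl r<)))))
    absurd (mkℚ -[1+ p ] q-1 _) r< (inj₂ lt) = <-irrefl refl (<-≤-trans lt
      (≤-trans (1≤^ 1≤y (suc q-1)) (subst (_≤ y ^ suc q-1 * ι n ^ suc p) (*-identityʳ (y ^ suc q-1))
        (mul-≤ˡ (^-nonNeg (≤-trans (nonNegative⁻¹ 1ℚ) 1≤y) (suc q-1)) (1≤^ (ι-mono {1} {n} (ℕ.>-nonZero⁻¹ n)) (suc p))))))

  -- Every element of the cut `a` is below d ≤ 2 L, so a quarter of it is below L/2, and e^(L/2) ≤
  -- 2ᴸ. The constant 1/4 is thus the product of the ½ lost in d ≤ 2 L and the ½ in e^½ ≤ 2.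
  exp⁻-bound : ∀ {a d L t} → (∀ y → a y → y < ι d) → d ℕ.≤ 2 ℕ.* L → exp⁻ ((+ 1 / 4) · a) t →
               1ℚ < ι (2 ℕ.^ L) * t
  exp⁻-bound {a} {d} {L} {t} a<d d≤2L (s , 0<s , (z , k , (y , ay , z<) , s<) , 1<st) =
    <-≤-trans 1<st (mul-≤ʳ 0≤t (<⇒≤ (<-≤-trans s< (≤-trans
      (expSum-mono (p≤p⊔q 0ℚ z) (⊔-lub (mul-nonNeg (ι-nonNeg L) 0≤½) (<⇒≤ z<½L)) k) (expSum-halves L k)))))
    where
    open ≤-Reasoning
    z<½L : z < ι L * ½
    z<½L = begin-strict
      z                            <⟨ z< ⟩
      (+ 1 / 4) * y                ≤⟨ mul-≤ˡ (nonNegative⁻¹ (+ 1 / 4)) (<⇒≤ (a<d y ay)) ⟩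
      (+ 1 / 4) * ι d              ≤⟨ mul-≤ˡ (nonNegative⁻¹ (+ 1 / 4)) (ι-mono {d} {2 ℕ.* L} d≤2L) ⟩
      (+ 1 / 4) * ι (2 ℕ.* L)      ≡⟨ cong (λ h → (+ 1 / 4) * h) (ι-* 2 L) ⟩
      (+ 1 / 4) * (ι 2 * ι L)      ≡⟨ solve 1 (λ l → con (+ 1 / 4) :* (con (ι 2) :* l) := l :* con ½) refl (ι L) ⟩
      ι L * ½                      ∎
      where open +-*-Solver
    0≤t : 0ℚ ≤ t
    0≤t with 0ℚ ≤? t
    ... | yes p = p
    ... | no ¬p = contradiction (<-trans 1<st (subst (s * t <_) (*-zeroʳ s) (*-monoʳ-<-pos s {{positive 0<s}} (≰⇒> ¬p))))
                    (<-asym (positive⁻¹ 1ℚ))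

  -- If x exceeded G/N, then N (1 - x) ≤ N - G ≤ B, and multiplication by 2ᴸ would give N < 2ᴸ N (1
  -- - x) ≤ B 2ᴸ ≤ N.
  probability-bound : ∀ {G B N L x} .{{_ : ℕ.NonZero N}} → N ℕ.≤ G ℕ.+ B → B ℕ.* 2 ℕ.^ L ℕ.≤ N →
                      1ℚ < ι (2 ℕ.^ L) * (1ℚ - x) → x ≤ + G / N
  probability-bound {G} {B} {N} {L} {x} N≤G+B B2ᴸ≤N 1<T[1-x] with x ≤? + G / N
  ... | yes x≤ = x≤
  ... | no  x≰ = contradiction (begin-strict
    ι N                              ≡⟨ *-identityʳ (ι N) ⟨
    ι N * 1ℚ                         <⟨ *-monoʳ-<-pos (ι N) {{positive (ι-pos N)}} 1<T[1-x] ⟩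
    ι N * (T * (1ℚ - x))             ≡⟨ solve 3 (λ n t x → n :* (t :* (con 1ℚ :- x)) := t :* (n :- x :* n)) refl (ι N) T x ⟩
    T * (ι N - x * ι N)              ≤⟨ mul-≤ˡ (ι-nonNeg (2 ℕ.^ L)) (+-mono-≤ (ι-mono {N} {G ℕ.+ B} N≤G+B) (neg-antimono-≤ (mul-≤ʳ (ι-nonNeg N) (<⇒≤ (≰⇒> x≰))))) ⟩
    T * (ι (G ℕ.+ B) - (+ G / N) * ι N)  ≡⟨ cong₂ (λ a b → T * (a - b)) (ι-+ G B) (/-*-ι G N) ⟩
    T * (ι G + ι B - ι G)            ≡⟨ solve 3 (λ t g b → t :* (g :+ b :- g) := b :* t) refl T (ι G) (ι B) ⟩
    ι B * T                          ≡⟨ ι-* B (2 ℕ.^ L) ⟨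
    ι (B ℕ.* 2 ℕ.^ L)                ≤⟨ ι-mono {B ℕ.* 2 ℕ.^ L} {N} B2ᴸ≤N ⟩
    ι N                              ∎) (<-irrefl refl)
    where
    open ≤-Reasoning
    open +-*-Solver
    T = ι (2 ℕ.^ L)

-- Ranks, oracles and the refinement of a partial classification by pivots.

module Comparisons where

  open Counting
  open import Defs
  open import Data.Bool using (Bool; true; false; if_then_else_)
  import Data.Bool.Properties as Bool
  open import Data.Fin using (Fin; zero; suc; toℕ)
  import Data.Fin.Properties as Fin
  open import Data.Fin.Permutation using (Permutation′; _⟨$⟩ʳ_)
  open import Data.List using (List; []; _∷_; map; filter; length; tabulate; allFin)
  open import Data.List.Properties using (map-tabulate)
  open import Data.List.Membership.Propositional using (_∈_; lose; find)
  open import Data.List.Relation.Unary.Any using (Any; here; there; any?)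
  open import Data.Empty using (⊥)
  open import Data.Nat
  open import Data.Nat.Properties
  open import Data.Product using (_×_; _,_)
  import Data.Product.Properties as Product
  open import Data.Unit using (⊤)
  open import Data.Vec using (Vec; []; _∷_)
  import Data.Vec as Vec
  open import Function using (_∘_)
  open import Relation.Binary.PropositionalEquality
  open import Relation.Nullary using (Dec; does; yes; no; ¬_; contradiction)
  open import Relation.Nullary.Decidable using (_×-dec_; dec-true; dec-false)
  open import Relation.Unary using (Decidable)
  import Algebra.Properties.CommutativeMonoid.Sum as Sum

  does-true : {P : Set} (P? : Dec P) → does P? ≡ true → P
  does-true (yes p) _ = p

  module ℕ-Sum = Sum +-0-commutativeMonoid

  count-tabulate : {A : Set} {P : A → Set} (P? : Decidable P) → ∀ {n} (f : Fin n → A) →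
                   count P? (tabulate f) ≡ ℕ-Sum.sum (λ i → if does (P? (f i)) then 1 else 0)
  count-tabulate P? {zero}  f = refl
  count-tabulate P? {suc n} f with does (P? (f zero))
  ... | true  = cong suc (count-tabulate P? (f ∘ suc))
  ... | false = count-tabulate P? (f ∘ suc)

  -- A count is a sum of indicators, and reindexing by a permutation preserves such a sum.
  count-permute : ∀ {n} {P : Fin n → Set} (P? : Decidable P) (π : Permutation′ n) →
                  count (P? ∘ (π ⟨$⟩ʳ_)) (allFin n) ≡ count P? (allFin n)
  count-permute P? π = begin
    count (P? ∘ (π ⟨$⟩ʳ_)) (allFin _)       ≡⟨ count-tabulate (P? ∘ (π ⟨$⟩ʳ_)) (λ i → i) ⟩
    ℕ-Sum.sum (λ i → indicator (π ⟨$⟩ʳ i))  ≡⟨ ℕ-Sum.sum-permute indicator π ⟨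
    ℕ-Sum.sum indicator                     ≡⟨ count-tabulate P? (λ i → i) ⟨
    count P? (allFin _)                     ∎
    where
    open ≡-Reasoning
    indicator = λ i → if does (P? i) then 1 else 0

  Between : ℕ → ℕ → ℕ → Set
  Between l r i = l ≤ i × i < r

  between? : ∀ l r → Decidable (Between l r)
  between? l r i = (l ≤? i) ×-dec (i <? r)

  count-shift : ∀ n l r l′ r′ → (∀ i → Between l r (suc i) → Between l′ r′ i) →
                (∀ i → Between l′ r′ i → Between l r (suc i)) →
                count (between? l r ∘ toℕ) (tabulate {n = n} suc) ≡ count (between? l′ r′ ∘ toℕ) (allFin n)
  count-shift n l r l′ r′ to from = begin
    count (between? l r ∘ toℕ) (tabulate {n = n} suc) ≡⟨ cong (count (between? l r ∘ toℕ)) (map-tabulate {n = n} (λ i → i) suc) ⟨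
    count (between? l r ∘ toℕ) (map suc (allFin n))   ≡⟨ count-map (between? l r ∘ toℕ) suc (allFin n) ⟩
    count (between? l r ∘ toℕ ∘ suc) (allFin n)       ≡⟨ count-cong _ _ (allFin n) (λ {x} _ → to (toℕ x)) (λ {x} _ → from (toℕ x)) ⟩
    count (between? l′ r′ ∘ toℕ) (allFin n)           ∎
    where open ≡-Reasoning

  count-between : ∀ n l r → r ≤ n → count (between? l r ∘ toℕ) (allFin n) ≡ r ∸ l
  count-between n       l       zero    _         =
    trans (count-none (between? l 0 ∘ toℕ) (λ _ ()) (allFin n)) (sym (0∸n≡0 l))
  count-between (suc n) zero    (suc r) (s≤s r≤n) =
    cong suc (trans (count-shift n 0 (suc r) 0 r (λ _ (_ , i<r) → z≤n , s≤s⁻¹ i<r) (λ _ (_ , i<r) → z≤n , s≤s i<r))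
      (count-between n 0 r r≤n))
  count-between (suc n) (suc l) (suc r) (s≤s r≤n) =
    trans (count-shift n (suc l) (suc r) l r (λ _ (l≤i , i<r) → s≤s⁻¹ l≤i , s≤s⁻¹ i<r) (λ _ (l≤i , i<r) → s≤s l≤i , s≤s i<r))
      (count-between n l r r≤n)

  rk : ∀ {n} → Permutation′ n → Fin n → ℕ
  rk π x = toℕ (π ⟨$⟩ʳ x)

  window? : ∀ {n} (π : Permutation′ n) l r → Decidable (Between l r ∘ rk π)
  window? π l r x = between? l r (rk π x)

  size-window : ∀ {n} (π : Permutation′ n) l r → r ≤ n → count (window? π l r) (allFin n) ≡ r ∸ l
  size-window π l r r≤n = trans (count-permute (between? l r ∘ toℕ) π) (count-between _ l r r≤n)

  module _ {n : ℕ} (π : Permutation′ n) {x y : Fin n} where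

    answer-true : rk π x < rk π y → answer π (x , y) ≡ true
    answer-true = dec-true (rk π x <? rk π y)

    answer-true⁻¹ : answer π (x , y) ≡ true → rk π x < rk π y
    answer-true⁻¹ = does-true (rk π x <? rk π y)

  Oracle : ℕ → Set
  Oracle n = Query n → Bool

  _≟ᵠ_ : ∀ {n} (p q : Query n) → Dec (p ≡ q)
  _≟ᵠ_ = Product.≡-dec Fin._≟_ Fin._≟_

  -- Turns the answer vector into a function on queries, so that later rounds need no positions of
  -- queries. The default `false` is read for queries that were not asked, hence for all queries of
  -- a skipped round.
  decode : ∀ {n} (qs : List (Query n)) → Vec Bool (length qs) → Oracle n
  decode []       []       q = false
  decode (p ∷ ps) (b ∷ bs) q = if does (p ≟ᵠ q) then b else decode ps bs q

  within : ∀ {A : Set} → ℕ → List A → List A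
  within B qs = if length qs ≤ᵇ B then qs else []

  length-within : ∀ {A : Set} B (qs : List A) → length (within B qs) ≤ B
  length-within B qs with length qs ≤ᵇ B in eq
  ... | true  = ≤ᵇ⇒≤ (length qs) B (subst Data.Bool.T (sym eq) _)
  ... | false = z≤n

  decode-correct : ∀ {n} (π : Permutation′ n) qs {q} → q ∈ qs →
                   decode qs (Vec.map (answer π) (Vec.fromList qs)) q ≡ answer π q
  decode-correct π (p ∷ ps) {q} q∈ with p ≟ᵠ q
  decode-correct π (p ∷ ps) q∈         | yes refl = refl
  decode-correct π (p ∷ ps) (here refl) | no p≢q  = contradiction refl p≢q
  decode-correct π (p ∷ ps) (there q∈) | no _     = decode-correct π ps q∈

  -- A round exceeding the budget B is skipped, which bounds the number of queries
  -- on every input.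
  abstract

    ask : ∀ {n r} → ℕ → List (Query n) → (Oracle n → Algorithm n r) → Algorithm n (suc r)
    ask B qs continue = round (Vec.fromList (within B qs)) (continue ∘ decode (within B qs))

    oracle : ∀ {n} → Permutation′ n → ℕ → List (Query n) → Oracle n
    oracle π B qs = decode (within B qs) (Vec.map (answer π) (Vec.fromList (within B qs)))

    accepted-ask : ∀ {n r} (π : Permutation′ n) B qs (continue : Oracle n → Algorithm n r) →
                   accepted (ask B qs continue) π ≡ accepted (continue (oracle π B qs)) π
    accepted-ask π B qs continue = refl

    queries-ask : ∀ {n r} (π : Permutation′ n) B qs (continue : Oracle n → Algorithm n r) k →
                  (∀ o → queries (continue o) π ≤ k) → queries (ask B qs continue) π ≤ B + k
    queries-ask π B qs continue k bound = +-mono-≤ (length-within B qs) (bound _)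

    oracle-correct : ∀ {n} (π : Permutation′ n) B qs → length qs ≤ B → ∀ {q} → q ∈ qs →
                     oracle π B qs q ≡ answer π q
    oracle-correct π B qs qs≤B q∈ with length qs ≤ᵇ B | ≤⇒≤ᵇ qs≤B
    ... | true | _ = decode-correct π qs q∈

  data Status : Set where
    low mid high : Status

  mid? : ∀ {n} (σ : Fin n → Status) → Decidable (λ x → σ x ≡ mid)
  mid? σ x with σ x
  ... | low  = no λ ()
  ... | mid  = yes refl
  ... | high = no λ ()

  mids : ∀ {n} → (Fin n → Status) → List (Fin n)
  mids σ = filter (mid? σ) (allFin _)

  resolve : {P Q : Set} → Status → Dec P → Dec Q → Status
  resolve low  _       _       = low
  resolve high _       _       = high
  resolve mid  (yes _) _       = low
  resolve mid  (no _)  (yes _) = high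
  resolve mid  (no _)  (no _)  = mid

  module _ {n : ℕ} (h : ℕ) (o : Oracle n) (σ : Fin n → Status) where

    KnownBelow : Fin n → Status → Fin n → Set
    KnownBelow u low  x = ⊤
    KnownBelow u mid  x = o (x , u) ≡ true
    KnownBelow u high x = ⊥

    knownBelow? : ∀ u s → Decidable (KnownBelow u s)
    knownBelow? u low  x = yes _
    knownBelow? u mid  x = o (x , u) Bool.≟ true
    knownBelow? u high x = no λ ()

    -- Exact for an undecided u, as the low elements lie below u and the high ones above.
    pivotRank : Fin n → ℕ
    pivotRank u = count (λ x → knownBelow? u (σ x) x) (allFin n)

    -- Ranks count from 0 and the target set is the ranks from `h` on. So a pivot of rank at most
    -- `h` rules out everything strictly below it, while a pivot of rank at least `h` certifies
    -- itself and everything above it. A pivot of rank `h` does both.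
    LowPivot HighPivot : Fin n → Fin n → Set
    LowPivot  x u = pivotRank u ≤ h × o (x , u) ≡ true
    HighPivot x u = h ≤ pivotRank u × o (x , u) ≡ false

    lowPivot? : ∀ x → Decidable (LowPivot x)
    lowPivot? x u = (pivotRank u ≤? h) ×-dec (o (x , u) Bool.≟ true)

    highPivot? : ∀ x → Decidable (HighPivot x)
    highPivot? x u = (h ≤? pivotRank u) ×-dec (o (x , u) Bool.≟ false)

    refine : List (Fin n) → Fin n → Status
    refine U x = resolve (σ x) (any? (lowPivot? x) U) (any? (highPivot? x) U)

  -- The last two fields keep the undecided elements a contiguous block of the order. This lets a
  -- later round find exact ranks from comparisons inside that block alone.
  record Sound {n : ℕ} (h : ℕ) (π : Permutation′ n) (σ : Fin n → Status) : Set where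
    field
      low-<    : ∀ {x} → σ x ≡ low → rk π x < h
      high-≥   : ∀ {x} → σ x ≡ high → h ≤ rk π x
      low-mid  : ∀ {x y} → σ x ≡ low → σ y ≡ mid → rk π x < rk π y
      mid-high : ∀ {x y} → σ x ≡ mid → σ y ≡ high → rk π x < rk π y

  open Sound

  module _ {n : ℕ} {h : ℕ} {π : Permutation′ n} {o : Oracle n} {σ : Fin n → Status} {U : List (Fin n)}
           (sound : Sound h π σ) (U-mid : ∀ {u} → u ∈ U → σ u ≡ mid)
           (correct : ∀ {x u} → σ x ≡ mid → u ∈ U → o (x , u) ≡ answer π (x , u)) where

    o-true : ∀ {x u} → σ x ≡ mid → u ∈ U → rk π x < rk π u → o (x , u) ≡ true
    o-true x-mid u∈ x<u = trans (correct x-mid u∈) (answer-true π x<u)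

    o-true⁻¹ : ∀ {x u} → σ x ≡ mid → u ∈ U → o (x , u) ≡ true → rk π x < rk π u
    o-true⁻¹ x-mid u∈ eq = answer-true⁻¹ π (trans (sym (correct x-mid u∈)) eq)

    o-false : ∀ {x u} → σ x ≡ mid → u ∈ U → rk π u ≤ rk π x → o (x , u) ≡ false
    o-false {x} {u} x-mid u∈ u≤x = trans (correct x-mid u∈) (dec-false (rk π x <? rk π u) (≤⇒≯ u≤x))

    o-false⁻¹ : ∀ {x u} → σ x ≡ mid → u ∈ U → o (x , u) ≡ false → rk π u ≤ rk π x
    o-false⁻¹ x-mid u∈ eq = ≮⇒≥ λ x<u → case-absurd (trans (sym (o-true x-mid u∈ x<u)) eq)
      where
      case-absurd : true ≢ false
      case-absurd ()

    pivotRank-correct : ∀ {u} → u ∈ U → pivotRank h o σ u ≡ rk π u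
    pivotRank-correct {u} u∈ = trans
      (count-cong (λ x → knownBelow? h o σ u (σ x) x) (window? π 0 (rk π u)) (allFin n) (λ {x} _ → to x) (λ {x} _ → from x))
      (size-window π 0 (rk π u) (<⇒≤ (Fin.toℕ<n (π ⟨$⟩ʳ u))))
      where
      to : ∀ x → KnownBelow h o σ u (σ x) x → Between 0 (rk π u) (rk π x)
      to x known with σ x in eq
      ... | low  = z≤n , low-mid sound eq (U-mid u∈)
      ... | mid  = z≤n , o-true⁻¹ eq u∈ known
      from : ∀ x → Between 0 (rk π u) (rk π x) → KnownBelow h o σ u (σ x) x
      from x (_ , x<u) with σ x in eq
      ... | low  = _
      ... | mid  = o-true eq u∈ x<u
      ... | high = contradiction (mid-high sound (U-mid u∈) eq) (<-asym x<u)

    lowPivot⁻¹ : ∀ {x u} → σ x ≡ mid → u ∈ U → LowPivot h o σ x u → rk π u ≤ h × rk π x < rk π u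
    lowPivot⁻¹ x-mid u∈ (u≤h , x<u) = subst (_≤ h) (pivotRank-correct u∈) u≤h , o-true⁻¹ x-mid u∈ x<u

    highPivot⁻¹ : ∀ {x u} → σ x ≡ mid → u ∈ U → HighPivot h o σ x u → h ≤ rk π u × rk π u ≤ rk π x
    highPivot⁻¹ x-mid u∈ (h≤u , u≤x) = subst (h ≤_) (pivotRank-correct u∈) h≤u , o-false⁻¹ x-mid u∈ u≤x

    low-pivot : ∀ {x u} → σ x ≡ mid → u ∈ U → rk π u ≤ h → rk π x < rk π u → Any (LowPivot h o σ x) U
    low-pivot x-mid u∈ u≤h x<u = lose u∈ (subst (_≤ h) (sym (pivotRank-correct u∈)) u≤h , o-true x-mid u∈ x<u)

    high-pivot : ∀ {x u} → σ x ≡ mid → u ∈ U → h ≤ rk π u → rk π u ≤ rk π x → Any (HighPivot h o σ x) U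
    high-pivot x-mid u∈ h≤u u≤x = lose u∈ (subst (h ≤_) (sym (pivotRank-correct u∈)) h≤u , o-false x-mid u∈ u≤x)

    -- The cause of each new status, stated with true ranks in place of oracle answers.
    data Refined (x : Fin n) : Status → Set where
      old-low  : σ x ≡ low → Refined x low
      old-high : σ x ≡ high → Refined x high
      new-low  : σ x ≡ mid → ∀ {u} → u ∈ U → rk π u ≤ h → rk π x < rk π u → Refined x low
      new-high : σ x ≡ mid → ∀ {u} → u ∈ U → h ≤ rk π u → rk π u ≤ rk π x → Refined x high
      still    : σ x ≡ mid → (∀ {u} → u ∈ U → rk π u ≤ h → rk π u ≤ rk π x) →
                 (∀ {u} → u ∈ U → h ≤ rk π u → rk π x < rk π u) → Refined x mid

    refined : ∀ x → Refined x (refine h o σ U x)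
    refined x with σ x in eq | any? (lowPivot? h o σ x) U | any? (highPivot? h o σ x) U
    ... | low  | _      | _     = old-low eq
    ... | high | _      | _     = old-high eq
    ... | mid  | yes lo | _     with find lo
    ...   | u , u∈ , p = let u≤h , x<u = lowPivot⁻¹ eq u∈ p in new-low eq u∈ u≤h x<u
    refined x | mid | no _ | yes hi with find hi
    ...   | u , u∈ , p = let h≤u , u≤x = highPivot⁻¹ eq u∈ p in new-high eq u∈ h≤u u≤x
    refined x | mid | no ¬lo | no ¬hi = still eq
      (λ u∈ u≤h → ≮⇒≥ λ x<u → ¬lo (low-pivot eq u∈ u≤h x<u))
      (λ u∈ h≤u → ≰⇒> λ u≤x → ¬hi (high-pivot eq u∈ h≤u u≤x))

    -- A pivot that makes an element low has rank at most `h`, so every element that stays undecided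
    -- lies at or above this pivot, hence above the newly low element. The high side is dual, and so
    -- the undecided block stays contiguous.
    refine-sound : Sound h π (refine h o σ U)
    refine-sound .low-< {x} eq with refine h o σ U x | refined x
    refine-sound .low-< refl | _ | old-low x-low       = low-< sound x-low
    refine-sound .low-< refl | _ | new-low _ _ u≤h x<u = <-≤-trans x<u u≤h
    refine-sound .high-≥ {x} eq with refine h o σ U x | refined x
    refine-sound .high-≥ refl | _ | old-high x-high      = high-≥ sound x-high
    refine-sound .high-≥ refl | _ | new-high _ _ h≤u u≤x = ≤-trans h≤u u≤x
    refine-sound .low-mid {x} {y} eq eq′ with refine h o σ U x | refined x | refine h o σ U y | refined y
    refine-sound .low-mid refl refl | _ | old-low x-low        | _ | still y-mid _ _ = low-mid sound x-low y-mid
    refine-sound .low-mid refl refl | _ | new-low _ u∈ u≤h x<u | _ | still _ above _ = <-≤-trans x<u (above u∈ u≤h)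
    refine-sound .mid-high {x} {y} eq eq′ with refine h o σ U x | refined x | refine h o σ U y | refined y
    refine-sound .mid-high refl refl | _ | still x-mid _ _ | _ | old-high y-high        = mid-high sound x-mid y-high
    refine-sound .mid-high refl refl | _ | still _ _ below | _ | new-high _ u∈ h≤u u≤y = <-≤-trans (below u∈ h≤u) u≤y

    refine-mid : ∀ {x} → refine h o σ U x ≡ mid → σ x ≡ mid ×
      (∀ {u} → u ∈ U → rk π u ≤ h → rk π u ≤ rk π x) × (∀ {u} → u ∈ U → h ≤ rk π u → rk π x < rk π u)
    refine-mid {x} eq with refine h o σ U x | refined x
    refine-mid refl | _ | still x-mid above below = x-mid , (λ {_} → above) , (λ {_} → below)

-- The four-round algorithm and its correctness for a good sample.

module Partitioning where

  open Counting
  open Comparisons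
  open import Defs
  open import Data.Bool using (true)
  import Data.Bool.Properties as Bool
  open import Data.Fin using (Fin; suc)
  open import Data.Fin.Permutation using (Permutation′)
  import Data.Fin.Subset as Subset
  open import Data.List using (List; []; _∷_; _++_; filter; length; allFin; take; cartesianProduct)
  open import Data.List.Properties using (length-tabulate; length-filter; length-++; length-take)
  open import Data.List.Membership.Propositional using (_∈_)
  open import Data.List.Membership.Propositional.Properties using (∈-filter⁺; ∈-filter⁻; ∈-allFin; ∈-cartesianProduct⁺; ∈-++⁺ˡ; ∈-++⁺ʳ)
  open import Data.List.Relation.Unary.Any using (here)
  open import Data.Nat
  open import Data.Nat.Properties
  open import Data.Product using (∃-syntax; _×_; _,_; proj₁; proj₂)
  open import Data.Vec using (Vec)
  import Data.Vec as Vec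
  import Data.Vec.Properties as Vec
  open import Function using (_∘_)
  open import Relation.Binary.PropositionalEquality
  open import Relation.Nullary using (does; yes; no; contradiction)
  open import Relation.Nullary.Decidable using (dec-true)
  open import Relation.Unary using (Decidable)

  high? : ∀ {n} (σ : Fin n → Status) → Decidable (λ x → σ x ≡ high)
  high? σ x with σ x
  ... | low  = no λ ()
  ... | mid  = no λ ()
  ... | high = yes refl

  -- `lo₁`, `hi₁` and `lo₂`, `hi₂` bound the sampled ranks at which a pivot may serve as the lower
  -- or the upper bracket. `#cut` is the length of the prefix that supplies the pivots of round 3.
  record Parameters : Set where
    field
      budget target       : ℕ
      #pivots #sample #cut : ℕ
      lo₁ hi₁ lo₂ hi₂     : ℕ

  module Partition (parameters : Parameters) {n m : ℕ} (v : Vec (Fin n) m) where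

    open Parameters parameters

    pivots sample cut : List (Fin n)
    pivots = prefix #pivots v
    sample = prefix #sample v
    cut    = prefix #cut v

    estimate : Oracle n → Fin n → ℕ
    estimate o x = count (λ y → o (y , x) Bool.≟ true) sample

    -- Any pivot with a suitable estimate will do; keeping at most one per side limits round 2 to 2
    -- n comparisons.
    pick : Oracle n → ℕ → ℕ → List (Fin n)
    pick o k₁ k₂ = take 1 (filter (between? k₁ k₂ ∘ estimate o) pivots)

    brackets : Oracle n → List (Fin n)
    brackets o = pick o lo₁ hi₁ ++ pick o lo₂ hi₂

    -- Rounds 2, 3 and 4 share this shape and differ only in their pivots: the brackets, the
    -- undecided elements of the cut, all undecided elements.
    stage : ∀ {r} → (Fin n → Status) → List (Fin n) → ((Fin n → Status) → Algorithm n r) → Algorithm n (suc r)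
    stage σ U continue = ask budget (cartesianProduct (mids σ) U) (λ o → continue (refine target o σ U))

    round₄ : (Fin n → Status) → Algorithm n 1
    round₄ σ = stage σ (mids σ) (λ σ′ → output (Vec.tabulate (does ∘ high? σ′)))

    round₃ : (Fin n → Status) → Algorithm n 2
    round₃ σ = stage σ (filter (mid? σ) cut) round₄

    round₂ : Oracle n → Algorithm n 3
    round₂ o = stage (λ _ → mid) (brackets o) round₃

    opaque

      algorithm : Algorithm n 4
      algorithm = ask budget (cartesianProduct sample pivots) round₂

    queries-stage : ∀ {r} π σ U (continue : (Fin n → Status) → Algorithm n r) k →
                    (∀ σ′ → queries (continue σ′) π ≤ k) → queries (stage σ U continue) π ≤ budget + k
    queries-stage π σ U continue k bound = queries-ask π budget (cartesianProduct (mids σ) U)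
      (λ o → continue (refine target o σ U)) k (λ o → bound (refine target o σ U))

    opaque
      unfolding algorithm

      queries-algorithm : ∀ π → queries algorithm π ≤ 4 * budget
      queries-algorithm π =
        queries-ask π budget (cartesianProduct sample pivots) round₂ (3 * budget) λ o →
        queries-stage π (λ _ → mid) (brackets o) round₃ (2 * budget) λ σ₁ →
        queries-stage π σ₁ (filter (mid? σ₁) cut) round₄ (1 * budget) λ σ₂ →
        queries-stage π σ₂ (mids σ₂) (λ σ′ → output (Vec.tabulate (does ∘ high? σ′))) 0 λ _ → z≤n

    module Correctness (π : Permutation′ n) where

      private
        h = target

      record Refinement (σ : Fin n → Status) (U : List (Fin n)) (σ′ : Fin n → Status) : Set where
        field
          sound    : Sound h π σ′
          mid⇒mid  : ∀ {x} → σ′ x ≡ mid → σ x ≡ mid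
          mid-≥    : ∀ {x u} → σ′ x ≡ mid → u ∈ U → rk π u ≤ h → rk π u ≤ rk π x
          mid-<    : ∀ {x u} → σ′ x ≡ mid → u ∈ U → h ≤ rk π u → rk π x < rk π u

      refinement : ∀ σ U → Sound h π σ → (∀ {u} → u ∈ U → σ u ≡ mid) → length (mids σ) * length U ≤ budget →
                   Refinement σ U (refine h (oracle π budget (cartesianProduct (mids σ) U)) σ U)
      refinement σ U sound U-mid fits = record
        { sound   = refine-sound sound U-mid correct
        ; mid⇒mid = λ x-mid → proj₁ (refine-mid sound U-mid correct x-mid)
        ; mid-≥   = λ x-mid → proj₁ (proj₂ (refine-mid sound U-mid correct x-mid))
        ; mid-<   = λ x-mid → proj₂ (proj₂ (refine-mid sound U-mid correct x-mid))
        }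
        where
        qs = cartesianProduct (mids σ) U
        correct : ∀ {x u} → σ x ≡ mid → u ∈ U → oracle π budget qs (x , u) ≡ answer π (x , u)
        correct x-mid u∈ = oracle-correct π budget qs
          (≤-trans (≤-reflexive (length-cartesianProductWith _,_ (mids σ) U)) fits)
          (∈-cartesianProduct⁺ (∈-filter⁺ (mid? σ) (∈-allFin _) x-mid) u∈)

      Exact : Subset.Subset n → Set
      Exact A = ∀ x → (h ≤ rk π x → x Subset.∈ A) × (x Subset.∈ A → h ≤ rk π x)

      stage-exact : ∀ {r} σ U (continue : (Fin n → Status) → Algorithm n r) →
                    Sound h π σ → (∀ {u} → u ∈ U → σ u ≡ mid) → length (mids σ) * length U ≤ budget →
                    (∀ σ′ → Refinement σ U σ′ → Exact (accepted (continue σ′) π)) →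
                    Exact (accepted (stage σ U continue) π)
      stage-exact σ U continue sound U-mid fits exact =
        subst Exact (sym (accepted-ask π budget (cartesianProduct (mids σ) U) (λ o → continue (refine h o σ U))))
        (exact (refine h (oracle π budget (cartesianProduct (mids σ) U)) σ U) (refinement σ U sound U-mid fits))

      mids-≤ : ∀ σ {l r} → r ≤ n → (∀ {x} → σ x ≡ mid → Between l r (rk π x)) → length (mids σ) ≤ r ∸ l
      mids-≤ σ {l} {r} r≤n inside = ≤-trans
        (count-mono (mid? σ) (window? π l r) (allFin n) (λ _ → inside))
        (≤-reflexive (size-window π l r r≤n))

      below-count : ℕ → ℕ
      below-count r = count (window? π 0 r) sample

      below-count-mono : ∀ {r r′} → r ≤ r′ → below-count r ≤ below-count r′
      below-count-mono r≤r′ = count-mono (window? π 0 _) (window? π 0 _) sample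
        (λ _ (_ , x<r) → z≤n , <-≤-trans x<r r≤r′)

      -- By monotonicity, a sampled rank of at least `k` forces the true rank above `r`, and a
      -- sampled rank below `k` forces it below `r + w`.
      Separated : ℕ → ℕ → ℕ → Set
      Separated w k r = below-count r < k × k ≤ below-count (r + w)

      -- Three adjacent windows of `w` ranks: the outer two absorb the uncertainty of the
      -- thresholds, and the middle one contains a pivot that surely passes both.
      record Bracketed (w k₁ k₂ r : ℕ) : Set where
        field
          lower-separated : Separated w k₁ r
          upper-separated : Separated w k₂ (r + (w + w))
          hit             : count (window? π (r + w) (r + (w + w))) pivots ≢ 0

      module _ {o : Oracle n} (correct : ∀ {y x} → y ∈ sample → x ∈ pivots → o (y , x) ≡ answer π (y , x)) where

        estimate-correct : ∀ {x} → x ∈ pivots → estimate o x ≡ below-count (rk π x)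
        estimate-correct x∈ = count-cong _ (window? π 0 _) sample
          (λ y∈ eq → z≤n , answer-true⁻¹ π (trans (sym (correct y∈ x∈)) eq))
          (λ y∈ (_ , y<x) → trans (correct y∈ x∈) (answer-true π y<x))

        -- The pivot in the middle window only shows that some pivot qualifies. The one picked may
        -- be another, but the two thresholds confine its rank to the three windows.
        pick-bracket : ∀ {w k₁ k₂ r} → Bracketed w k₁ k₂ r →
                       ∃[ a ] pick o k₁ k₂ ≡ a ∷ [] × Between r (r + (w + w) + w) (rk π a)
        pick-bracket {w} {k₁} {k₂} {r} bracketed with count-some _ pivots hit
          where open Bracketed bracketed
        ... | x , x∈ , r+w≤x , x<r+2w
          with filter (between? k₁ k₂ ∘ estimate o) pivots in eq
             | ∈-filter⁺ (between? k₁ k₂ ∘ estimate o) x∈ (subst (Between k₁ k₂) (sym (estimate-correct x∈)) x-between)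
          where
          open Bracketed bracketed
          x-between : Between k₁ k₂ (below-count (rk π x))
          x-between = ≤-trans (proj₂ lower-separated) (below-count-mono r+w≤x) ,
                      ≤-<-trans (below-count-mono (<⇒≤ x<r+2w)) (proj₁ upper-separated)
        ... | a ∷ as | _ = a , refl , a-lower , a-upper
          where
          open Bracketed bracketed
          a∈ : a ∈ pivots × Between k₁ k₂ (estimate o a)
          a∈ = ∈-filter⁻ (between? k₁ k₂ ∘ estimate o) (subst (a ∈_) (sym eq) (here refl))
          a-between : Between k₁ k₂ (below-count (rk π a))
          a-between = subst (Between k₁ k₂) (estimate-correct (proj₁ a∈)) (proj₂ a∈)
          a-lower : r ≤ rk π a
          a-lower = ≮⇒≥ λ a<r → <-irrefl refl
            (<-≤-trans (≤-<-trans (below-count-mono (<⇒≤ a<r)) (proj₁ lower-separated)) (proj₁ a-between))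
          a-upper : rk π a < r + (w + w) + w
          a-upper = ≰⇒> λ r+3w≤a → <-irrefl refl
            (<-≤-trans (proj₂ a-between) (≤-trans (proj₂ upper-separated) (below-count-mono r+3w≤a)))

      -- The interface between probability and correctness. The lower bracket has its three windows
      -- just below `h`, the upper one from `h` on; the last four fields ensure that no round is
      -- skipped.
      record Good (g w w′ j : ℕ) : Set where
        field
          g+3w≡h  : g + (w + w) + w ≡ h
          h+3w≤n  : h + (w + w) + w ≤ n
          h+w′≤n  : h + w′ ≤ n
          below   : Bracketed w lo₁ hi₁ g
          above   : Bracketed w lo₂ hi₂ h
          few     : count (window? π g (h + (w + w) + w)) cut < j
          hit-below : count (window? π (h ∸ w′) h) cut ≢ 0
          hit-above : count (window? π h (h + w′)) cut ≢ 0
          fits₁   : length sample * length pivots ≤ budget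
          fits₂   : n * 2 ≤ budget
          fits₃   : (h + (w + w) + w ∸ g) * j ≤ budget
          fits₄   : (h + w′ ∸ (h ∸ w′)) * (h + w′ ∸ (h ∸ w′)) ≤ budget

      module _ {g w w′ j : ℕ} (good : Good g w w′ j) where

        open Good good
        open Refinement

        σ₀ : Fin n → Status
        σ₀ _ = mid

        sound₀ : Sound h π σ₀
        sound₀ = record { low-< = λ () ; high-≥ = λ () ; low-mid = λ () ; mid-high = λ _ () }

        correct₁ : ∀ {y x} → y ∈ sample → x ∈ pivots →
                   oracle π budget (cartesianProduct sample pivots) (y , x) ≡ answer π (y , x)
        correct₁ y∈ x∈ = oracle-correct π budget (cartesianProduct sample pivots)
          (≤-trans (≤-reflexive (length-cartesianProductWith _,_ sample pivots)) fits₁) (∈-cartesianProduct⁺ y∈ x∈)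

        within₁ : ∀ o → length (mids σ₀) * length (brackets o) ≤ budget
        within₁ o = ≤-trans (*-mono-≤
          (≤-trans (length-filter (mid? σ₀) (allFin n)) (≤-reflexive (length-tabulate {n = n} (λ i → i))))
          (≤-trans (≤-reflexive (length-++ (pick o lo₁ hi₁))) (+-mono-≤ (length-pick lo₁ hi₁) (length-pick lo₂ hi₂)))) fits₂
          where
          length-pick : ∀ k₁ k₂ → length (pick o k₁ k₂) ≤ 1
          length-pick k₁ k₂ = ≤-trans (≤-reflexive (length-take 1 (filter (between? k₁ k₂ ∘ estimate o) pivots))) (m⊓n≤m 1 _)

        mid₁ : ∀ {o} → (∀ {y x} → y ∈ sample → x ∈ pivots → o (y , x) ≡ answer π (y , x)) →
               ∀ {σ₁} → Refinement σ₀ (brackets o) σ₁ →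
               ∀ {x} → σ₁ x ≡ mid → Between g (h + (w + w) + w) (rk π x)
        mid₁ {o} correct r {x} x-mid with pick-bracket correct below | pick-bracket correct above
        ... | a , a≡ , g≤a , a<h | b , b≡ , h≤b , b<h+3w =
          ≤-trans g≤a (mid-≥ r x-mid a∈ (<⇒≤ (<-≤-trans a<h (≤-reflexive g+3w≡h)))) ,
          <-trans (mid-< r x-mid b∈ h≤b) b<h+3w
          where
          a∈ : a ∈ brackets o
          a∈ = ∈-++⁺ˡ (subst (a ∈_) (sym a≡) (here refl))
          b∈ : b ∈ brackets o
          b∈ = ∈-++⁺ʳ (pick o lo₁ hi₁) (subst (b ∈_) (sym b≡) (here refl))

        module _ {σ₁ : Fin n → Status} (sound₁ : Sound h π σ₁)
                 (mid₁ : ∀ {x} → σ₁ x ≡ mid → Between g (h + (w + w) + w) (rk π x)) where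

          within₂ : length (mids σ₁) * length (filter (mid? σ₁) cut) ≤ budget
          within₂ = ≤-trans (*-mono-≤ (mids-≤ σ₁ h+3w≤n mid₁)
            (≤-trans (count-mono (mid? σ₁) (window? π g (h + (w + w) + w)) cut (λ _ → mid₁)) (<⇒≤ few))) fits₃

          module _ {σ₂ : Fin n → Status} (r : Refinement σ₁ (filter (mid? σ₁) cut) σ₂) where

            -- A cut element in the window next to `h` bounds `x` in either case: if it was still
            -- undecided, it is a pivot of round 3; if round 2 has decided it, soundness places it
            -- on the right side of the undecided block.
            mid₂ : ∀ {x} → σ₂ x ≡ mid → Between (h ∸ w′) (h + w′) (rk π x)
            mid₂ {x} x-mid = lower-bound , upper-bound
              where
              x-mid₁ = mid⇒mid r x-mid
              lower-bound : h ∸ w′ ≤ rk π x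
              lower-bound with count-some _ cut hit-below
              ... | u , u∈ , h-w′≤u , u<h with σ₁ u in eq
              ...   | low  = ≤-trans h-w′≤u (<⇒≤ (Sound.low-mid sound₁ eq x-mid₁))
              ...   | mid  = ≤-trans h-w′≤u (mid-≥ r x-mid (∈-filter⁺ (mid? σ₁) u∈ eq) (<⇒≤ u<h))
              ...   | high = contradiction (Sound.high-≥ sound₁ eq) (<⇒≱ u<h)
              upper-bound : rk π x < h + w′
              upper-bound with count-some _ cut hit-above
              ... | u , u∈ , h≤u , u<h+w′ with σ₁ u in eq
              ...   | low  = contradiction (Sound.low-< sound₁ eq) (≤⇒≯ h≤u)
              ...   | mid  = <-trans (mid-< r x-mid (∈-filter⁺ (mid? σ₁) u∈ eq) h≤u) u<h+w′
              ...   | high = <-trans (Sound.mid-high sound₁ x-mid₁ eq) u<h+w′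

            within₃ : length (mids σ₂) * length (mids σ₂) ≤ budget
            within₃ = ≤-trans (*-mono-≤ (mids-≤ σ₂ h+w′≤n mid₂) (mids-≤ σ₂ h+w′≤n mid₂)) fits₄

            -- In the last round every undecided element is also a pivot.
            high₃ : ∀ {σ₃} → Refinement σ₂ (mids σ₂) σ₃ → ∀ x → h ≤ rk π x → σ₃ x ≡ high
            high₃ {σ₃} r₃ x h≤x with σ₃ x in eq
            ... | low  = contradiction (Sound.low-< (sound r₃) eq) (≤⇒≯ h≤x)
            ... | high = refl
            ... | mid  = contradiction
              (mid-< r₃ eq (∈-filter⁺ (mid? σ₂) (∈-allFin x) (mid⇒mid r₃ eq)) h≤x) (<-irrefl refl)

        output-exact : ∀ σ → Sound h π σ → (∀ x → h ≤ rk π x → σ x ≡ high) →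
                       Exact (Vec.tabulate (does ∘ high? σ))
        output-exact σ sound is-high x =
          (λ h≤x → Vec.lookup⇒[]= x _ (trans (Vec.lookup∘tabulate (does ∘ high? σ) x) (dec-true (high? σ x) (is-high x h≤x)))) ,
          (λ x∈ → Sound.high-≥ sound (does-true (high? σ x)
            (trans (sym (Vec.lookup∘tabulate (does ∘ high? σ) x)) (Vec.[]=⇒lookup x∈))))

        round₄-exact : ∀ {σ₁} → Sound h π σ₁ → (∀ {x} → σ₁ x ≡ mid → Between g (h + (w + w) + w) (rk π x)) →
                       ∀ σ₂ → Refinement σ₁ (filter (mid? σ₁) cut) σ₂ → Exact (accepted (round₄ σ₂) π)
        round₄-exact sound₁ mid₁ σ₂ r₂ = stage-exact σ₂ (mids σ₂) (λ σ′ → output (Vec.tabulate (does ∘ high? σ′))) (sound r₂)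
          (λ u∈ → proj₂ (∈-filter⁻ (mid? σ₂) {xs = allFin n} u∈)) (within₃ sound₁ mid₁ r₂)
          (λ σ₃ r₃ → output-exact σ₃ (sound r₃) (high₃ sound₁ mid₁ r₂ r₃))

        round₃-exact : ∀ {o} → (∀ {y x} → y ∈ sample → x ∈ pivots → o (y , x) ≡ answer π (y , x)) →
                       ∀ σ₁ → Refinement σ₀ (brackets o) σ₁ → Exact (accepted (round₃ σ₁) π)
        round₃-exact {o} correct σ₁ r₁ = stage-exact σ₁ (filter (mid? σ₁) cut) round₄ (sound r₁)
          (λ u∈ → proj₂ (∈-filter⁻ (mid? σ₁) {xs = cut} u∈)) (within₂ (sound r₁) (mid₁ {o} correct r₁))
          (round₄-exact (sound r₁) (mid₁ {o} correct r₁))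

        round₂-exact : ∀ o → (∀ {y x} → y ∈ sample → x ∈ pivots → o (y , x) ≡ answer π (y , x)) →
                       Exact (accepted (round₂ o) π)
        round₂-exact o correct =
          stage-exact σ₀ (brackets o) round₃ sound₀ (λ _ → refl) (within₁ o) (round₃-exact {o} correct)

        opaque
          unfolding algorithm

          algorithm-exact : Exact (accepted algorithm π)
          algorithm-exact = subst Exact (sym (accepted-ask π budget (cartesianProduct sample pivots) round₂))
            (round₂-exact (oracle π budget (cartesianProduct sample pivots)) correct₁)

-- Integer roots, the choice of the constants and their inequalities.

module Sizes where

  open import Data.Nat
  open import Data.Nat.DivMod
  open import Data.Nat.Properties
  open import Data.Nat.Tactic.RingSolver using (solve-∀)
  open import Data.Product using (_×_; _,_; proj₁; proj₂)
  open import Relation.Binary.PropositionalEquality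
  open import Relation.Nullary using (yes; no)
  open Counting using (^-distribʳ-*)

  -- The integer part of the `q`-th root for `q` positive, found by climbing: it grows by at most 1
  -- when `n` does.
  root : ℕ → ℕ → ℕ
  root q zero    = 0
  root q (suc n) with suc (root q n) ^ q ≤? suc n
  ... | yes _ = suc (root q n)
  ... | no  _ = root q n

  root-lower : ∀ q n .{{_ : NonZero q}} → root q n ^ q ≤ n
  root-lower (suc q) zero = z≤n
  root-lower q (suc n) with suc (root q n) ^ q ≤? suc n
  ... | yes le = le
  ... | no  _  = m≤n⇒m≤1+n (root-lower q n)

  root-upper : ∀ q n .{{_ : NonZero q}} → n < suc (root q n) ^ q
  root-upper q zero = m^n>0 1 q
  root-upper q (suc n) with suc (root q n) ^ q ≤? suc n
  -- `root-upper q n` already says suc n ≤ (r + 1)^q for the old root r; the new bound (r + 2)^q is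
  -- larger still.
  ... | yes _ = ≤-<-trans (root-upper q n) (^-monoˡ-< q (n<1+n (suc (root q n))))
  ... | no ≰  = ≰⇒> ≰

  -- A positive r satisfies r + 1 ≤ 2 r. Thus rounding the root up costs only a constant factor in
  -- its `q`-th power.
  root-double : ∀ q n .{{_ : NonZero q}} → 1 ≤ root q n → suc (root q n) ^ q ≤ 2 ^ q * n
  root-double q n 1≤r = begin
    suc r ^ q         ≤⟨ ^-monoˡ-≤ q (+-monoˡ-≤ r 1≤r) ⟩
    (r + r) ^ q       ≡⟨ cong (λ x → (r + x) ^ q) (+-identityʳ r) ⟨
    (2 * r) ^ q       ≡⟨ ^-distribʳ-* 2 r q ⟩
    2 ^ q * r ^ q     ≤⟨ *-monoʳ-≤ (2 ^ q) (root-lower q n) ⟩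
    2 ^ q * n         ∎
    where
    open ≤-Reasoning
    r = root q n

  -- Abstract, so that its multiples are not unfolded.
  abstract

    factor : ℕ
    factor = 2 ^ 18

    2¹⁸≤factor : 2 ^ 18 ≤ factor
    2¹⁸≤factor = ≤-refl

  module Choice (n d : ℕ) .{{_ : NonZero n}} .{{_ : NonZero d}} where

    -- The factor e (e + 1) in `s` matches the denominators of the tail bound with relative error
    -- 1/e. The slack `u` is at least 2 n/e, and `w` has room for it on both sides of a threshold.
    -- `j` is twice the sum of `d` and 36 e, where 36 e bounds, for large `n`, the mean number of
    -- the first `t` draws that land in the 12 u ranks around the median.
    e s p t h u w w′ j budget : ℕ
    e  = d ^ 5
    s  = d * (e * suc e)
    p  = d * e
    t  = e * e
    h  = n / 2
    u  = suc ((2 * n / e) {{m^n≢0 d 5}})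
    w  = u + u
    w′ = suc ((n / d ^ 9) {{m^n≢0 d 9}})
    j  = 2 * (36 * e + d)
    budget = factor * n

    -- On average s (r + u) / n sample elements have rank below r + u, so suc (κ r)
    -- separates the numbers of those with rank below r and below r + w.
    κ : ℕ → ℕ
    κ r = s * (r + u) / n

    instance
      e≢0 : NonZero e
      e≢0 = m^n≢0 d 5
      d⁹≢0 : NonZero (d ^ 9)
      d⁹≢0 = m^n≢0 d 9

    g : ℕ
    g = h ∸ (w + w + w)

    1≤e : 1 ≤ e
    1≤e = >-nonZero⁻¹ e

    d≤e : d ≤ e
    d≤e = m≤m*n d (d ^ 4) {{m^n≢0 d 4}}

    p≤s : p ≤ s
    p≤s = *-monoʳ-≤ d (m≤m*n e (suc e))

    t≤s : t ≤ s
    t≤s = ≤-trans (*-monoʳ-≤ e (n≤1+n e)) (m≤n*m (e * suc e) d)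

    ceiling : ∀ a b .{{_ : NonZero b}} → a ≤ b * suc (a / b)
    ceiling a b = begin
      a                     ≡⟨ m≡m%n+[m/n]*n a b ⟩
      a % b + a / b * b     ≤⟨ +-monoˡ-≤ (a / b * b) (<⇒≤ (m%n<n a b)) ⟩
      suc (a / b) * b       ≡⟨ *-comm (suc (a / b)) b ⟩
      b * suc (a / b)       ∎
      where open ≤-Reasoning

    ceiling-≤ : ∀ a b .{{_ : NonZero b}} → b * suc (a / b) ≤ a + b
    ceiling-≤ a b = begin
      b * suc (a / b)       ≡⟨ *-comm b (suc (a / b)) ⟩
      b + a / b * b         ≤⟨ +-monoʳ-≤ b (m/n*n≤m a b) ⟩
      b + a                 ≡⟨ +-comm b a ⟩
      a + b                 ∎
      where open ≤-Reasoning

    2n≤eu : 2 * n ≤ e * u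
    2n≤eu = ceiling (2 * n) e

    -- This prepares `many-rare` for `r` elements and `s` draws. Both excess terms are at most n s:
    -- the relative error costs r s, and the deviation (1 + e) d e n equals n s by the choice of
    -- `s`. As e u ≥ 2 n, replacing `r` by `r + u` pays for both.
    tail-condition : ∀ r k → r ≤ n → s * (r + u) ≤ n * k → suc e * (r * s + d * (e * n)) ≤ e * n * k
    tail-condition r k r≤n s[r+u]≤nk = begin
      suc e * (r * s + d * (e * n))     ≡⟨ solve₁ e r s d n ⟩
      e * (r * s) + (r * s + n * s)     ≤⟨ +-monoʳ-≤ (e * (r * s)) (+-monoˡ-≤ (n * s) (*-monoˡ-≤ s r≤n)) ⟩
      e * (r * s) + (n * s + n * s)     ≡⟨ solve₂ e r s n ⟩
      e * (r * s) + s * (2 * n)         ≤⟨ +-monoʳ-≤ (e * (r * s)) (*-monoʳ-≤ s 2n≤eu) ⟩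
      e * (r * s) + s * (e * u)         ≡⟨ solve₃ e r s u ⟩
      e * (s * (r + u))                 ≤⟨ *-monoʳ-≤ e s[r+u]≤nk ⟩
      e * (n * k)                       ≡⟨ *-assoc e n k ⟨
      e * n * k                         ∎
      where
      open ≤-Reasoning
      solve₁ : ∀ e r s d n → suc e * (r * s + d * (e * n)) ≡ e * (r * s) + (r * s + n * (d * (e * suc e)))
      solve₁ = solve-∀
      solve₂ : ∀ e r s n → e * (r * s) + (n * s + n * s) ≡ e * (r * s) + s * (2 * n)
      solve₂ = solve-∀
      solve₃ : ∀ e r s u → e * (r * s) + s * (e * u) ≡ e * (s * (r + u))
      solve₃ = solve-∀

    upper-condition : ∀ r → r ≤ n → suc e * (r * s + d * (e * n)) ≤ e * n * suc (κ r)
    upper-condition r r≤n = tail-condition r (suc (κ r)) r≤n (ceiling (s * (r + u)) n)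

    -- A shortage of draws below `r + w` is an excess of draws from there on, so the upper tail
    -- bound serves again. Because `w` is twice `u`, the shares s (q + u) and s (r + u) add up to
    -- exactly s n.
    lower-condition : ∀ r → r + w ≤ n → suc e * ((n ∸ (r + w)) * s + d * (e * n)) ≤ e * n * (s ∸ κ r)
    lower-condition r r+w≤n = tail-condition q (s ∸ κ r) (m∸n≤m n (r + w)) (begin
      s * (q + u)              ≤⟨ m+n≤o⇒m≤o∸n (s * (q + u)) total ⟩
      n * s ∸ n * κ r          ≡⟨ *-distribˡ-∸ n s (κ r) ⟨
      n * (s ∸ κ r)            ∎)
      where
      open ≤-Reasoning
      q = n ∸ (r + w)
      solve₁ : ∀ s q u r → s * (q + u) + s * (r + u) ≡ s * (r + (u + u) + q)
      solve₁ = solve-∀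
      total : s * (q + u) + n * κ r ≤ n * s
      total = begin
        s * (q + u) + n * κ r          ≡⟨ cong (s * (q + u) +_) (*-comm n (κ r)) ⟩
        s * (q + u) + κ r * n          ≤⟨ +-monoʳ-≤ (s * (q + u)) (m/n*n≤m (s * (r + u)) n) ⟩
        s * (q + u) + s * (r + u)      ≡⟨ solve₁ s q u r ⟩
        s * (r + w + q)                ≡⟨ cong (s *_) (m+[n∸m]≡n r+w≤n) ⟩
        s * n                          ≡⟨ *-comm s n ⟩
        n * s                          ∎

    bracket-hit-condition : n * d ≤ w * p
    bracket-hit-condition = begin
      n * d               ≤⟨ m≤m+n (n * d) (n * d) ⟩
      n * d + n * d       ≡⟨ solve₁ n d ⟩
      d * (2 * n)         ≤⟨ *-monoʳ-≤ d 2n≤eu ⟩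
      d * (e * u)         ≤⟨ m≤m+n (d * (e * u)) (d * (e * u)) ⟩
      d * (e * u) + d * (e * u) ≡⟨ solve₂ d e u ⟩
      w * p               ∎
      where
      open ≤-Reasoning
      solve₁ : ∀ n d → n * d + n * d ≡ d * (2 * n)
      solve₁ = solve-∀
      solve₂ : ∀ d e u → d * (e * u) + d * (e * u) ≡ (u + u) * (d * e)
      solve₂ = solve-∀

    t≡d¹⁰ : t ≡ d * d ^ 9
    t≡d¹⁰ = sym (^-distribˡ-+-* d 5 5)

    cut-hit-condition : n * d ≤ w′ * t
    cut-hit-condition = begin
      n * d               ≤⟨ *-monoˡ-≤ d (ceiling n (d ^ 9)) ⟩
      d ^ 9 * w′ * d      ≡⟨ solve₁ (d ^ 9) w′ d ⟩
      w′ * (d * d ^ 9)    ≡⟨ cong (w′ *_) t≡d¹⁰ ⟨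
      w′ * t              ∎
      where
      open ≤-Reasoning
      solve₁ : ∀ a b c → a * b * c ≡ b * (c * a)
      solve₁ = solve-∀

    module Large (n<d¹⁸ : n < d ^ 18) (d¹⁸≤2¹⁸n : d ^ 18 ≤ 2 ^ 18 * n) (8≤d : 8 ≤ d) where

      multiple-≤ : ∀ k → k ≤ 2 ^ 18 → k * n ≤ budget
      multiple-≤ k k≤ = *-monoˡ-≤ n (≤-trans k≤ 2¹⁸≤factor)

      power-≤ : ∀ k → 8 ^ k ≤ d ^ k
      power-≤ k = ^-monoˡ-≤ k 8≤d

      d⁹≤n : d ^ 9 ≤ n
      d⁹≤n = *-cancelˡ-≤ (2 ^ 18) (begin
        -- 2¹⁸ = 4⁹ is at most 8⁹.
        2 ^ 18 * d ^ 9       ≤⟨ *-monoˡ-≤ (d ^ 9) (≤-trans (≤ᵇ⇒≤ (2 ^ 18) (8 ^ 9) _) (power-≤ 9)) ⟩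
        d ^ 9 * d ^ 9        ≡⟨ ^-distribˡ-+-* d 9 9 ⟨
        d ^ 18               ≤⟨ d¹⁸≤2¹⁸n ⟩
        2 ^ 18 * n           ∎)
        where open ≤-Reasoning

      e≤n : e ≤ n
      e≤n = ≤-trans (^-monoʳ-≤ d {5} {9} (≤ᵇ⇒≤ 5 9 _)) d⁹≤n

      eu≤3n : e * u ≤ 3 * n
      eu≤3n = begin
        e * u          ≤⟨ ceiling-≤ (2 * n) e ⟩
        2 * n + e      ≤⟨ +-monoʳ-≤ (2 * n) e≤n ⟩
        2 * n + n      ≡⟨ +-comm (2 * n) n ⟩
        3 * n          ∎
        where open ≤-Reasoning

      12u≤n : 12 * u ≤ n
      12u≤n = *-cancelˡ-≤ e (begin
        e * (12 * u)      ≡⟨ solve₁ e u ⟩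
        12 * (e * u)      ≤⟨ *-monoʳ-≤ 12 eu≤3n ⟩
        12 * (3 * n)      ≡⟨ *-assoc 12 3 n ⟨
        36 * n            ≤⟨ *-monoˡ-≤ n (≤-trans (≤ᵇ⇒≤ 36 (8 ^ 5) _) (power-≤ 5)) ⟩
        e * n             ∎)
        where
        open ≤-Reasoning
        solve₁ : ∀ e u → e * (12 * u) ≡ 12 * (e * u)
        solve₁ = solve-∀

      half : ∀ {a} → 2 * a ≤ n → a ≤ h × h + a ≤ n
      half {a} 2a≤n = ≤-trans (≤-reflexive (sym (m*n/n≡m a 2))) (/-monoˡ-≤ 2 (≤-trans (≤-reflexive (*-comm a 2)) 2a≤n)) ,
        *-cancelˡ-≤ 2 (begin
          2 * (h + a)        ≡⟨ *-distribˡ-+ 2 h a ⟩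
          2 * h + 2 * a      ≤⟨ +-mono-≤ (≤-trans (≤-reflexive (*-comm 2 h)) (m/n*n≤m n 2)) 2a≤n ⟩
          n + n              ≡⟨ cong (n +_) (+-identityʳ n) ⟨
          2 * n              ∎)
        where open ≤-Reasoning

      3w-fits : w + w + w ≤ h × h + (w + w + w) ≤ n
      3w-fits = half (≤-trans (≤-reflexive (solve₁ u)) 12u≤n)
        where
        solve₁ : ∀ u → 2 * ((u + u) + (u + u) + (u + u)) ≡ 12 * u
        solve₁ = solve-∀

      g+3w≡h : g + (w + w) + w ≡ h
      g+3w≡h = trans (+-assoc g (w + w) w) (m∸n+n≡m (proj₁ 3w-fits))

      h+3w≤n : h + (w + w) + w ≤ n
      h+3w≤n = ≤-trans (≤-reflexive (+-assoc h (w + w) w)) (proj₂ 3w-fits)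

      d⁹w′≤2n : d ^ 9 * w′ ≤ 2 * n
      d⁹w′≤2n = begin
        d ^ 9 * w′     ≤⟨ ceiling-≤ n (d ^ 9) ⟩
        n + d ^ 9      ≤⟨ +-monoʳ-≤ n d⁹≤n ⟩
        n + n          ≡⟨ cong (n +_) (+-identityʳ n) ⟨
        2 * n          ∎
        where open ≤-Reasoning

      w′-fits : w′ ≤ h × h + w′ ≤ n
      w′-fits = half (*-cancelˡ-≤ 2 (begin
        2 * (2 * w′)    ≡⟨ *-assoc 2 2 w′ ⟨
        4 * w′          ≤⟨ *-monoˡ-≤ w′ (≤-trans (≤ᵇ⇒≤ 4 (8 ^ 9) _) (power-≤ 9)) ⟩
        d ^ 9 * w′      ≤⟨ d⁹w′≤2n ⟩
        2 * n           ∎))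
        where open ≤-Reasoning

      middle-width : h + (w + w) + w ∸ g ≡ 12 * u
      middle-width = begin
        h + (w + w) + w ∸ g                         ≡⟨ cong (λ x → x + (w + w) + w ∸ g) g+3w≡h ⟨
        g + (w + w) + w + (w + w) + w ∸ g           ≡⟨ cong (_∸ g) (solve₁ g u) ⟩
        g + 12 * u ∸ g                              ≡⟨ m+n∸m≡n g (12 * u) ⟩
        12 * u                                      ∎
        where
        open ≡-Reasoning
        solve₁ : ∀ g u → g + ((u + u) + (u + u)) + (u + u) + ((u + u) + (u + u)) + (u + u) ≡ g + 12 * u
        solve₁ = solve-∀

      -- The tail bound with relative error 1: twice the mean plus 2 d. Since e u ≤ 3 n and t = e²,
      -- the mean is at most 36 e.
      few-condition : 2 * (12 * u * t + d * (1 * n)) ≤ 1 * n * j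
      few-condition = begin
        2 * (12 * u * (e * e) + d * (1 * n))     ≡⟨ solve₁ u e d n ⟩
        2 * (12 * e * (e * u) + d * n)           ≤⟨ *-monoʳ-≤ 2 (+-monoˡ-≤ (d * n) (*-monoʳ-≤ (12 * e) eu≤3n)) ⟩
        2 * (12 * e * (3 * n) + d * n)           ≡⟨ solve₂ e d n ⟩
        1 * n * j                                ∎
        where
        open ≤-Reasoning
        solve₁ : ∀ u e d n → 2 * (12 * u * (e * e) + d * (1 * n)) ≡ 2 * (12 * e * (e * u) + d * n)
        solve₁ = solve-∀
        solve₂ : ∀ e d n → 2 * (12 * e * (3 * n) + d * n) ≡ 1 * n * (2 * (36 * e + d))
        solve₂ = solve-∀

      -- The product is at most 2 d² e³ = 2 d¹⁷, and the spare factor `d` absorbs the 2.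
      fits₁ : s * p ≤ budget
      fits₁ = begin
        d * (e * suc e) * (d * e)       ≤⟨ *-monoˡ-≤ (d * e) (*-monoʳ-≤ d (*-monoʳ-≤ e (+-monoˡ-≤ e 1≤e))) ⟩
        d * (e * (e + e)) * (d * e)     ≡⟨ solve₁ d e ⟩
        2 * (d * d * (e * e * e))       ≤⟨ *-monoˡ-≤ (d * d * (e * e * e)) (≤-trans (s≤s (s≤s z≤n)) 8≤d) ⟩
        d * (d * d * (e * e * e))       ≡⟨ solve₂ d (e * e * e) ⟩
        d * (d * (d * 1)) * (e * e * e) ≡⟨ cong (λ x → d ^ 3 * (x * e)) (^-distribˡ-+-* d 5 5) ⟨
        d ^ 3 * (d ^ 10 * e)            ≡⟨ cong (d ^ 3 *_) (^-distribˡ-+-* d 10 5) ⟨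
        d ^ 3 * d ^ 15                  ≡⟨ ^-distribˡ-+-* d 3 15 ⟨
        d ^ 18                          ≤⟨ ≤-trans d¹⁸≤2¹⁸n (multiple-≤ (2 ^ 18) ≤-refl) ⟩
        budget                          ∎
        where
        open ≤-Reasoning
        solve₁ : ∀ d e → d * (e * (e + e)) * (d * e) ≡ 2 * (d * d * (e * e * e))
        solve₁ = solve-∀
        solve₂ : ∀ d e → d * (d * d * e) ≡ d * (d * (d * 1)) * e
        solve₂ = solve-∀

      fits₂ : n * 2 ≤ budget
      fits₂ = ≤-trans (≤-reflexive (*-comm n 2)) (multiple-≤ 2 (≤ᵇ⇒≤ 2 (2 ^ 18) _))

      fits₃ : (h + (w + w) + w ∸ g) * j ≤ budget
      fits₃ = begin
        (h + (w + w) + w ∸ g) * j           ≡⟨ cong (_* j) middle-width ⟩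
        12 * u * (2 * (36 * e + d))         ≤⟨ *-monoʳ-≤ (12 * u) (*-monoʳ-≤ 2 (+-monoʳ-≤ (36 * e) d≤e)) ⟩
        12 * u * (2 * (36 * e + e))         ≡⟨ solve₁ u e ⟩
        888 * (e * u)                       ≤⟨ *-monoʳ-≤ 888 eu≤3n ⟩
        888 * (3 * n)                       ≡⟨ *-assoc 888 3 n ⟨
        2664 * n                            ≤⟨ multiple-≤ 2664 (≤ᵇ⇒≤ 2664 (2 ^ 18) _) ⟩
        budget                              ∎
        where
        open ≤-Reasoning
        solve₁ : ∀ u e → 12 * u * (2 * (36 * e + e)) ≡ 888 * (e * u)
        solve₁ = solve-∀

      fits₄ : (h + w′ ∸ (h ∸ w′)) * (h + w′ ∸ (h ∸ w′)) ≤ budget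
      fits₄ = begin
        (h + w′ ∸ (h ∸ w′)) * (h + w′ ∸ (h ∸ w′))   ≡⟨ cong (λ x → x * x) width ⟩
        2 * w′ * (2 * w′)                          ≤⟨ *-cancelʳ-≤ (2 * w′ * (2 * w′)) (16 * n) n scaled ⟩
        16 * n                                     ≤⟨ multiple-≤ 16 (≤ᵇ⇒≤ 16 (2 ^ 18) _) ⟩
        budget                                     ∎
        where
        open ≤-Reasoning
        width : h + w′ ∸ (h ∸ w′) ≡ 2 * w′
        width = begin-equality
          h + w′ ∸ (h ∸ w′)                  ≡⟨ cong (λ x → x + w′ ∸ (h ∸ w′)) (m∸n+n≡m (proj₁ w′-fits)) ⟨
          h ∸ w′ + w′ + w′ ∸ (h ∸ w′)        ≡⟨ cong (_∸ (h ∸ w′)) (trans (+-assoc (h ∸ w′) w′ w′) (cong (λ x → h ∸ w′ + (w′ + x)) (sym (+-identityʳ w′)))) ⟩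
          h ∸ w′ + 2 * w′ ∸ (h ∸ w′)         ≡⟨ m+n∸m≡n (h ∸ w′) (2 * w′) ⟩
          2 * w′                             ∎
        solve₁ : ∀ w x → 2 * w * (2 * w) * (x * x) ≡ 4 * (x * w * (x * w))
        solve₁ = solve-∀
        solve₂ : ∀ n → 4 * (2 * n * (2 * n)) ≡ 16 * n * n
        solve₂ = solve-∀
        -- Enlarging the factor n to d¹⁸ = (d⁹)² completes both copies of w′ to d⁹ w′, which is at
        -- most 2 n.
        scaled : 2 * w′ * (2 * w′) * n ≤ 16 * n * n
        scaled = begin
          2 * w′ * (2 * w′) * n                    ≤⟨ *-monoʳ-≤ (2 * w′ * (2 * w′)) (<⇒≤ n<d¹⁸) ⟩
          2 * w′ * (2 * w′) * d ^ 18               ≡⟨ cong (2 * w′ * (2 * w′) *_) (^-distribˡ-+-* d 9 9) ⟩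
          2 * w′ * (2 * w′) * (d ^ 9 * d ^ 9)      ≡⟨ solve₁ w′ (d ^ 9) ⟩
          4 * (d ^ 9 * w′ * (d ^ 9 * w′))          ≤⟨ *-monoʳ-≤ 4 (*-mono-≤ d⁹w′≤2n d⁹w′≤2n) ⟩
          4 * (2 * n * (2 * n))                    ≡⟨ solve₂ n ⟩
          16 * n * n                               ∎

-- From exact partitions to zero error, and the union bound over the bad events.

module Analysis where

  open Counting
  open Exponential
  open Comparisons
  open Partitioning
  open Sizes
  open import Defs
  open import Data.Fin using (Fin; toℕ)
  import Data.Fin.Properties as Fin
  open import Data.Fin.Permutation using (Permutation′; _⟨$⟩ʳ_; _⟨$⟩ˡ_; inverseʳ)
  import Data.Fin.Subset as Subset
  import Data.Fin.Subset.Properties as Subset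
  open import Data.Integer using (+_)
  open import Data.List using (List; []; _∷_; _++_; map; filter; length; allFin; cartesianProduct; lookup)
  open import Data.List.Properties using (filter-++; length-++; map-tabulate; tabulate-lookup)
  open import Data.List.Relation.Unary.All using (All; []; _∷_)
  open import Data.List.Relation.Unary.All.Properties using (all-filter)
  open import Data.Nat
  open import Data.Nat.DivMod using (m<n*o⇒m/o<n; m*n/n≡m; /-monoˡ-≤)
  open import Data.Nat.Properties
  open import Data.Product using (_×_; _,_; proj₁; proj₂)
  import Data.Rational as ℚ
  import Data.Rational.Properties as ℚ
  open import Data.Sum using (inj₁; inj₂)
  open import Data.Vec using (Vec)
  open import Function using (_∘_; Equivalence; mk⇔)
  open import Relation.Binary.PropositionalEquality
  open import Relation.Nullary using (Dec; yes; no; ¬_; contradiction; ¬?)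
  open import Relation.Unary using (Decidable; _∪_)
  open import Relation.Unary.Properties using (_∪?_)

  count-∁ : {A : Set} {P : A → Set} (P? : Decidable P) → ∀ xs → count P? xs + count (¬? ∘ P?) xs ≡ length xs
  count-∁ P? [] = refl
  count-∁ P? (x ∷ xs) with P? x
  ... | yes _ = cong suc (count-∁ P? xs)
  ... | no _  = trans (+-suc _ _) (cong suc (count-∁ P? xs))

  -- A bound that holds for each hidden order separately survives summation over all orders.
  count-cartesianProduct : {A B : Set} {P : A × B → Set} (P? : Decidable P) → ∀ c K xs ys →
    (∀ x → count (λ y → P? (x , y)) ys * c ≤ K) → count P? (cartesianProduct xs ys) * c ≤ length xs * K
  count-cartesianProduct P? c K []       ys bound = z≤n
  count-cartesianProduct P? c K (x ∷ xs) ys bound = begin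
    count P? (map (x ,_) ys ++ cartesianProduct xs ys) * c
      ≡⟨ cong (_* c) (trans (cong length (filter-++ P? (map (x ,_) ys) _)) (length-++ (filter P? (map (x ,_) ys)))) ⟩
    (count P? (map (x ,_) ys) + count P? (cartesianProduct xs ys)) * c
      ≡⟨ cong (λ k → (k + count P? (cartesianProduct xs ys)) * c) (count-map P? (x ,_) ys) ⟩
    (count (λ y → P? (x , y)) ys + count P? (cartesianProduct xs ys)) * c
      ≡⟨ *-distribʳ-+ c (count (λ y → P? (x , y)) ys) _ ⟩
    count (λ y → P? (x , y)) ys * c + count P? (cartesianProduct xs ys) * c
      ≤⟨ +-mono-≤ (bound x) (count-cartesianProduct P? c K xs ys bound) ⟩
    K + length xs * K ∎
    where open ≤-Reasoning

  count-lookup : {A : Set} {P : A → Set} (P? : Decidable P) (xs : List A) →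
                 count (P? ∘ lookup xs) (allFin (length xs)) ≡ count P? xs
  count-lookup P? xs = trans (sym (count-map P? (lookup xs) (allFin (length xs))))
    (cong (count P?) (trans (map-tabulate (λ i → i) (lookup xs)) (tabulate-lookup xs)))

  ⊕-zero : ∀ {a b} → a ≐ 0ᶜ → b ≐ 0ᶜ → a ⊕ b ≐ 0ᶜ
  ⊕-zero za zb x = mk⇔
    (λ (y , z , ay , bz , x<) → ℚ.<-trans x< (ℚ.+-mono-< (Equivalence.to (za y) ay) (Equivalence.to (zb z) bz)))
    (⊕-neg (isZero za) (isZero zb))

  sum-zero : ∀ {A : Set} {P : A → Set} {f : A → LowerCut} {is} →
             (∀ i → P i → f i ≐ 0ᶜ) → All P is → sumᶜ is f ≐ 0ᶜ
  sum-zero z [] x     = mk⇔ (λ p → p) (λ p → p)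
  sum-zero z (p ∷ ps) = ⊕-zero (z _ p) (sum-zero z ps)

  I-zero : ∀ {P : Set} {a} (P? : Dec P) → ¬ P → (I[ P? ] a) ≐ 0ᶜ
  I-zero (yes p) ¬p x = contradiction p ¬p
  I-zero (no _)  _  x = mk⇔ (λ p → p) (λ p → p)

  ι-cancel-< : ∀ {m n} → ι m ℚ.< ι n → m < n
  ι-cancel-< {m} {n} m<n = ≰⇒> λ n≤m → ℚ.<-irrefl refl (ℚ.<-≤-trans m<n (ι-mono {n} {m} n≤m))

  median-*2 : ∀ n → median n ℚ.* ι 2 ≡ ι n
  median-*2 n = /-*-ι n 2

  -- `rank` counts from 1, so n < 2 (i + 1) yields ⌊n/2⌋ ≤ i. For even n the element of rank n/2 is
  -- in neither error sum; the cutoff ⌊n/2⌋ on ranks from 0 rejects it.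
  above⇒≥ : ∀ {n} (i : Fin n) → median n ℚ.< rank i → n / 2 ≤ toℕ i
  above⇒≥ {n} i m<r = s≤s⁻¹ (m<n*o⇒m/o<n (ι-cancel-< {n} {suc (toℕ i) * 2}
    (subst₂ ℚ._<_ (median-*2 n) (sym (ι-* (suc (toℕ i)) 2)) (ℚ.*-monoˡ-<-pos (ι 2) m<r))))

  below⇒< : ∀ {n} (i : Fin n) → rank i ℚ.< median n → toℕ i < n / 2
  below⇒< {n} i r<m = ≤-trans (≤-reflexive (sym (m*n/n≡m (suc (toℕ i)) 2))) (/-monoˡ-≤ 2 (<⇒≤
    (ι-cancel-< {suc (toℕ i) * 2} {n}
      (subst₂ ℚ._<_ (sym (ι-* (suc (toℕ i)) 2)) (median-*2 n) (ℚ.*-monoˡ-<-pos (ι 2) r<m)))))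

  exact⇒zeroError : ∀ {n} c (π : Permutation′ n) A →
    (∀ x → (n / 2 ≤ rk π x → x Subset.∈ A) × (x Subset.∈ A → n / 2 ≤ rk π x)) → ZeroError c π A
  exact⇒zeroError {n} c π A exact = ⊕-zero
    (sum-zero (λ i m<r → I-zero (π ⟨$⟩ˡ i Subset.∈? Subset.∁ A)
      (λ ∈∁ → Subset.x∈∁p⇒x∉p ∈∁ (proj₁ (exact _) (subst (n / 2 ≤_) (rk-position i) (above⇒≥ i m<r)))))
      (all-filter above? (allFin n)))
    (sum-zero (λ i r<m → I-zero (π ⟨$⟩ˡ i Subset.∈? A)
      (λ ∈A → <⇒≱ (below⇒< i r<m) (subst (n / 2 ≤_) (sym (rk-position i)) (proj₂ (exact _) ∈A))))
      (all-filter below? (allFin n)))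
    where
    rk-position : ∀ i → toℕ i ≡ rk π (π ⟨$⟩ˡ i)
    rk-position i = cong toℕ (sym (inverseʳ π))

  module Failure (n d : ℕ) .{{_ : NonZero n}} .{{_ : NonZero d}} where

    open Sampling n
    open Choice n d

    parameters : Parameters
    parameters = record
      { budget = budget ; target = h ; #pivots = p ; #sample = s ; #cut = t
      ; lo₁ = suc (κ g) ; hi₁ = suc (κ (g + (w + w))) ; lo₂ = suc (κ h) ; hi₂ = suc (κ (h + (w + w)))
      }

    record Event : Set₁ where
      field
        Holds  : Vec (Fin n) s → Set
        holds? : Decidable Holds

    open Event

    infixr 6 _or_

    _or_ : Event → Event → Event
    (E or F) .Holds  = Holds E ∪ Holds F
    (E or F) .holds? = holds? E ∪? holds? F

    -- Probability at most c 2⁻ᵈ, where `c` counts the elementary events joined in `E`.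
    record Rare (c : ℕ) (E : Event) : Set where
      constructor rare
      field
        bound : count (holds? E) (samples s) * 2 ^ d ≤ c * n ^ s

    rare-or : ∀ {E F a b} → Rare a E → Rare b F → Rare (a + b) (E or F)
    rare-or {E} {F} {a} {b} (rare rareE) (rare rareF) = rare (begin
      count (holds? E ∪? holds? F) (samples s) * 2 ^ d                           ≤⟨ *-monoˡ-≤ (2 ^ d) (count-∪ (holds? E) (holds? F) (samples s)) ⟩
      (count (holds? E) (samples s) + count (holds? F) (samples s)) * 2 ^ d      ≡⟨ *-distribʳ-+ (2 ^ d) (count (holds? E) (samples s)) _ ⟩
      count (holds? E) (samples s) * 2 ^ d + count (holds? F) (samples s) * 2 ^ d ≤⟨ +-mono-≤ rareE rareF ⟩
      a * n ^ s + b * n ^ s                                                      ≡⟨ *-distribʳ-+ (n ^ s) a b ⟨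
      (a + b) * n ^ s                                                            ∎)
      where open ≤-Reasoning

    module _ (π : Permutation′ n) where

      crowded : ℕ → ℕ → ℕ → ℕ → Event
      crowded l r k i = record { Holds = λ v → i ≤ hits (window? π l r) k v ; holds? = many? (window? π l r) k i }

      missed : ℕ → ℕ → ℕ → Event
      missed l r k = record { Holds = λ v → hits (window? π l r) k v ≡ 0 ; holds? = none? (window? π l r) k }

      crowded-rare : ∀ l r k i ε .{{_ : NonZero ε}} → k ≤ s → r ≤ n →
        suc ε * ((r ∸ l) * k + d * (ε * n)) ≤ ε * n * i → Rare 1 (crowded l r k i)
      crowded-rare l r k i ε k≤s r≤n hyp = rare (≤-trans
        (many-rare (window? π l r) ε k s i d k≤s
          (subst (λ q → suc ε * (q * k + d * (ε * n)) ≤ ε * n * i) (sym (size-window π l r r≤n)) hyp))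
        (≤-reflexive (sym (*-identityˡ (n ^ s)))))

      missed-rare : ∀ l r k → k ≤ s → r ≤ n → n * d ≤ (r ∸ l) * k → Rare 1 (missed l r k)
      missed-rare l r k k≤s r≤n hyp = rare (≤-trans
        (none-rare (window? π l r) k s d k≤s (subst (λ q → n * d ≤ q * k) (sym (size-window π l r r≤n)) hyp))
        (≤-reflexive (sym (*-identityˡ (n ^ s)))))

      -- Both ways for the threshold `suc (κ r)` to fail are phrased as an excess of hits, so that
      -- `many-rare` covers them.
      misjudged : ℕ → Event
      misjudged r = crowded 0 r s (suc (κ r)) or crowded (r + w) n s (s ∸ κ r)

      misjudged-rare : ∀ r → r + w ≤ n → Rare 2 (misjudged r)
      misjudged-rare r r+w≤n = rare-or
        (crowded-rare 0 r s (suc (κ r)) e ≤-refl r≤n (upper-condition r r≤n))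
        (crowded-rare (r + w) n s (s ∸ κ r) e ≤-refl ≤-refl (lower-condition r r+w≤n))
        where
        r≤n : r ≤ n
        r≤n = ≤-trans (m≤m+n r w) r+w≤n

      unbracketed : ℕ → Event
      unbracketed r = misjudged r or misjudged (r + (w + w)) or missed (r + w) (r + (w + w)) p

      unbracketed-rare : ∀ r → r + (w + w) + w ≤ n → Rare 5 (unbracketed r)
      unbracketed-rare r r+3w≤n = rare-or
        (misjudged-rare r (≤-trans (+-monoʳ-≤ r (m≤m+n w w)) r+2w≤n))
        (rare-or (misjudged-rare (r + (w + w)) r+3w≤n)
          (missed-rare (r + w) (r + (w + w)) p p≤s r+2w≤n
            (subst (λ q → n * d ≤ q * p) (sym width) bracket-hit-condition)))
        where
        r+2w≤n : r + (w + w) ≤ n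
        r+2w≤n = ≤-trans (m≤m+n (r + (w + w)) w) r+3w≤n
        width : r + (w + w) ∸ (r + w) ≡ w
        width = trans (cong (_∸ (r + w)) (sym (+-assoc r w w))) (m+n∸m≡n (r + w) w)

      -- Each bracket contributes 2 + 2 + 1 elementary events and the three conditions on the cut
      -- one each, 13 in all.
      bad : Event
      bad = unbracketed g or unbracketed h or crowded g (h + (w + w) + w) t j or
            missed (h ∸ w′) h t or missed h (h + w′) t

      module _ (n<d¹⁸ : n < d ^ 18) (d¹⁸≤2¹⁸n : d ^ 18 ≤ 2 ^ 18 * n) (8≤d : 8 ≤ d) where

        open Large n<d¹⁸ d¹⁸≤2¹⁸n 8≤d

        h≤n : h ≤ n
        h≤n = ≤-trans (m≤m+n h w′) (proj₂ w′-fits)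

        bad-rare : Rare 13 bad
        bad-rare =
          rare-or (unbracketed-rare g (≤-trans (≤-reflexive g+3w≡h) h≤n))
          (rare-or (unbracketed-rare h h+3w≤n)
          (rare-or (crowded-rare g (h + (w + w) + w) t j 1 t≤s h+3w≤n
            (subst (λ q → 2 * (q * t + d * (1 * n)) ≤ 1 * n * j) (sym middle-width) few-condition))
          (rare-or
            (missed-rare (h ∸ w′) h t t≤s h≤n (subst (λ q → n * d ≤ q * t) (sym (m∸[m∸n]≡n (proj₁ w′-fits))) cut-hit-condition))
            (missed-rare h (h + w′) t t≤s (proj₂ w′-fits) (subst (λ q → n * d ≤ q * t) (sym (m+n∸m≡n h w′)) cut-hit-condition)))))

        module _ (v : Vec (Fin n) s) where

          open Partition parameters v
          open Correctness π

          split-count : ∀ c → s ≤ below-count c + hits (window? π c n) s v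
          split-count c = ≤-trans (≤-reflexive (sym (length-prefix s v ≤-refl))) (go sample)
            where
            go : ∀ xs → length xs ≤ count (window? π 0 c) xs + count (window? π c n) xs
            go xs = ≤-trans (≤-reflexive (sym (count-∁ (window? π 0 c) xs)))
              (+-monoʳ-≤ (count (window? π 0 c) xs) (count-mono (¬? ∘ window? π 0 c) (window? π c n) xs
                (λ {x} _ ≮ → ≮⇒≥ (λ x<c → ≮ (z≤n , x<c)) , Fin.toℕ<n (π ⟨$⟩ʳ x))))

          separated : ∀ r → ¬ Holds (misjudged r) v → Separated w (suc (κ r)) r
          separated r ok = ≰⇒> (λ many → ok (inj₁ many)) ,
            -- With at most κ r draws below `r + w`, at least s - κ r draws lie at or above it,
            -- which is the second event.
            ≰⇒> λ few → ok (inj₂ (m≤n+o⇒m∸n≤o s (κ r) (≤-trans (split-count (r + w)) (+-monoˡ-≤ (hits (window? π (r + w) n) s v) few))))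

          bracketed : ∀ r → ¬ Holds (unbracketed r) v → Bracketed w (suc (κ r)) (suc (κ (r + (w + w)))) r
          bracketed r ok = record
            { lower-separated = separated r (ok ∘ inj₁)
            ; upper-separated = separated (r + (w + w)) (ok ∘ inj₂ ∘ inj₁)
            ; hit             = ok ∘ inj₂ ∘ inj₂
            }

          good : ¬ Holds bad v → Good g w w′ j
          good ok = record
            { g+3w≡h = g+3w≡h ; h+3w≤n = h+3w≤n ; h+w′≤n = proj₂ w′-fits
            ; below     = bracketed g (ok ∘ inj₁)
            ; above     = bracketed h (ok ∘ inj₂ ∘ inj₁)
            ; few       = ≰⇒> (ok ∘ inj₂ ∘ inj₂ ∘ inj₁)
            ; hit-below = ok ∘ inj₂ ∘ inj₂ ∘ inj₂ ∘ inj₁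
            ; hit-above = ok ∘ inj₂ ∘ inj₂ ∘ inj₂ ∘ inj₂
            ; fits₁     = ≤-trans (≤-reflexive (cong₂ _*_ (length-prefix s v ≤-refl) (length-prefix p v p≤s))) fits₁
            ; fits₂     = fits₂ ; fits₃ = fits₃ ; fits₄ = fits₄
            }

          zero-error : ¬ Holds bad v → ∀ c → ZeroError c π (accepted algorithm π)
          zero-error ok c = exact⇒zeroError c π (accepted algorithm π) (algorithm-exact (good ok))

-- The randomized algorithm and its success probability.

open Counting
open Exponential
open Comparisons
open Partitioning
open Sizes
open Analysis
open import Defs
open import Data.Fin using (Fin)
open import Data.Fin.Permutation using (Permutation′)
open import Data.Integer using (+_)
open import Data.List using (length; allFin; lookup; cartesianProduct)
open import Data.List.Properties using (length-tabulate)
open import Data.Nat as ℕ using (ℕ; zero; suc; _!; z≤n; s≤s; NonZero)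
import Data.Nat.Properties as ℕ
open import Data.Nat.Tactic.RingSolver using (solve-∀)
open import Data.Product using (Σ; ∃-syntax; _×_; _,_)
open import Data.Rational using (ℚ; 0ℚ; 1ℚ; _<_; _/_)
import Data.Rational as ℚ
import Data.Rational.Properties as ℚ
open import Data.Vec using (Vec)
open import Function using (_∘_)
open import Relation.Binary.PropositionalEquality
open import Relation.Nullary using (¬?)
open import Relation.Nullary.Decidable using (decidable-stable)
open import Relation.Unary using (Decidable)

-- Kept abstract because powers of a successor unfold exponentially.
abstract

  scale : ℕ → ℕ → ℕ
  scale q n = suc (root q n)

  scale-nonZero : ∀ q n → NonZero (scale q n)
  scale-nonZero q n = _

  scale-upper : ∀ q n .{{_ : NonZero q}} → n ℕ.< scale q n ℕ.^ q
  scale-upper q n = root-upper q n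

  scale-lower : ∀ q n .{{_ : NonZero q}} → 2 ℕ.≤ scale q n → scale q n ℕ.^ q ℕ.≤ 2 ℕ.^ q ℕ.* n
  scale-lower q n 2≤scale = root-double q n (ℕ.s≤s⁻¹ 2≤scale)

scale-large : ∀ q n b .{{_ : NonZero q}} → b ℕ.^ q ℕ.≤ n → b ℕ.< scale q n
scale-large q n b large = ℕ.≰⇒> λ small →
  ℕ.<⇒≱ (ℕ.<-≤-trans (scale-upper q n) (ℕ.^-monoˡ-≤ q small)) large

module _ (n : ℕ) .{{_ : NonZero n}} where

  private instance
    _ : NonZero (scale 18 n)
    _ = scale-nonZero 18 n

  open Sampling n
  open Choice n (scale 18 n) using (s)
  open Failure n (scale 18 n)

  partitioner : RandomizedAlgorithm n 4
  partitioner = record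
    -- A seed is an index into the list of all vectors of `s` positions, so a uniform seed amounts
    -- to `s` independent uniform draws.
    { seeds         = length (samples s)
    ; seeds-nonZero = subst NonZero (sym (length-samples s)) (ℕ.m^n≢0 n s)
    ; run           = λ i → Partition.algorithm parameters (lookup (samples s) i)
    }

  partitioner-queries : ∀ π seed → queries (run partitioner seed) π ℕ.≤ 4 ℕ.* factor ℕ.* n
  partitioner-queries π seed = ℕ.≤-trans (Partition.queries-algorithm parameters (lookup (samples s) seed) π)
    (ℕ.≤-reflexive (sym (ℕ.*-assoc 4 factor n)))

  module _ (large : 7 ℕ.^ 18 ℕ.≤ n) (c : ℝ) where

    private
      d = scale 18 n
      -- The factor 13 of the union bound is below 2⁴, so the failure probability is at most 2^(4 -
      -- d) = 2⁻ᴸ.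
      L = d ℕ.∸ 4

      -- The threshold 7¹⁸ for `n` forces d > 7, and d ≥ 8 is exactly the condition for d ≤ 2 (d -
      -- 4).
      8≤d : 8 ℕ.≤ d
      8≤d = scale-large 18 n 7 large

      d¹⁸≤2¹⁸n : d ℕ.^ 18 ℕ.≤ 2 ℕ.^ 18 ℕ.* n
      d¹⁸≤2¹⁸n = scale-lower 18 n (ℕ.≤-trans (ℕ.≤ᵇ⇒≤ 2 8 _) 8≤d)

      4+L≡d : 4 ℕ.+ L ≡ d
      4+L≡d = ℕ.m+[n∸m]≡n (ℕ.≤-trans (ℕ.≤ᵇ⇒≤ 4 8 _) 8≤d)

    scale-≤ : d ℕ.≤ 2 ℕ.* L
    scale-≤ = begin
      d              ≡⟨ 4+L≡d ⟨
      4 ℕ.+ L        ≤⟨ ℕ.+-monoˡ-≤ L (ℕ.+-cancelˡ-≤ 4 4 L (ℕ.≤-trans 8≤d (ℕ.≤-reflexive (sym 4+L≡d)))) ⟩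
      L ℕ.+ L        ≡⟨ cong (L ℕ.+_) (ℕ.+-identityʳ L) ⟨
      2 ℕ.* L        ∎
      where open ℕ.≤-Reasoning

    Success : Permutation′ n × Fin (length (samples s)) → Set
    Success (π , seed) = ZeroError c π (accepted (run partitioner seed) π)

    success? : Decidable Success
    success? (π , seed) = zeroError? c π (accepted (run partitioner seed) π)

    failures-≤ : ∀ π → count (λ seed → ¬? (success? (π , seed))) (allFin (length (samples s))) ℕ.* 2 ℕ.^ L ℕ.≤ length (samples s)
    failures-≤ π = ℕ.*-cancelˡ-≤ 16 (begin
      16 ℕ.* (count (λ seed → ¬? (success? (π , seed))) (allFin (length (samples s))) ℕ.* 2 ℕ.^ L)
        ≤⟨ ℕ.*-monoʳ-≤ 16 (ℕ.*-monoˡ-≤ (2 ℕ.^ L) fewer) ⟩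
      16 ℕ.* (bads ℕ.* 2 ℕ.^ L)      ≡⟨ solve₁ bads (2 ℕ.^ L) ⟩
      bads ℕ.* (16 ℕ.* 2 ℕ.^ L)      ≡⟨ cong (bads ℕ.*_) (ℕ.^-distribˡ-+-* 2 4 L) ⟨
      bads ℕ.* 2 ℕ.^ (4 ℕ.+ L)       ≡⟨ cong (λ k → bads ℕ.* 2 ℕ.^ k) 4+L≡d ⟩
      bads ℕ.* 2 ℕ.^ d               ≤⟨ Rare.bound (bad-rare π (scale-upper 18 n) d¹⁸≤2¹⁸n 8≤d) ⟩
      13 ℕ.* n ℕ.^ s                 ≤⟨ ℕ.*-monoˡ-≤ (n ℕ.^ s) (ℕ.≤ᵇ⇒≤ 13 16 _) ⟩
      16 ℕ.* n ℕ.^ s                 ≡⟨ cong (16 ℕ.*_) (length-samples s) ⟨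
      16 ℕ.* length (samples s)      ∎)
      where
      open ℕ.≤-Reasoning
      bads = count (Event.holds? (bad π)) (samples s)
      solve₁ : ∀ a b → 16 ℕ.* (a ℕ.* b) ≡ a ℕ.* (16 ℕ.* b)
      solve₁ = solve-∀
      fewer : count (λ seed → ¬? (success? (π , seed))) (allFin (length (samples s))) ℕ.≤ bads
      fewer = ℕ.≤-trans
        (count-mono (λ seed → ¬? (success? (π , seed))) (Event.holds? (bad π) ∘ lookup (samples s)) (allFin (length (samples s)))
          -- The contrapositive of `zero-error` yields only the double negation of the bad event,
          -- which is decidable.
          (λ {seed} _ failure → decidable-stable (Event.holds? (bad π) (lookup (samples s) seed))
            (λ ok → failure (zero-error π (scale-upper 18 n) d¹⁸≤2¹⁸n 8≤d (lookup (samples s) seed) ok c))))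
        (ℕ.≤-reflexive (count-lookup (Event.holds? (bad π)) (samples s)))

    -- Failures have frequency at most 2⁻ᴸ, while e^(-n^ε/4) is at least 2⁻ᴸ because n^ε is at most
    -- d ≤ 2 L.
    partitioner-success : ∀ {ε} → ε ʳ< (+ 1 / 18) →
      (1- exp⁻ ((+ 1 / 4) · ((+ n / 1) ^ᶜ ε))) ≤ᶜ Pr[zeroError] c partitioner
    partitioner-success {ε} ε< x x< = probability-bound {count success? outcomes} {count (¬? ∘ success?) outcomes} {n ! ℕ.* length (samples s)} {L} {x}
      {{ℕ.m*n≢0 (n !) (length (samples s)) {{n ℕ.!≢0}} {{seeds-nonZero partitioner}}}}
      (ℕ.≤-reflexive (sym (trans (count-∁ success? outcomes) total)))
      (ℕ.≤-trans (count-cartesianProduct (¬? ∘ success?) (2 ℕ.^ L) (length (samples s)) (permutations n) (allFin (length (samples s))) failures-≤)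
        (ℕ.≤-reflexive (cong (ℕ._* length (samples s)) (length-permutations n))))
      (exp⁻-bound {(+ n / 1) ^ᶜ ε} {d} {L} {1ℚ ℚ.- x} (λ y → power-< {ε} {n} {d} {y} ε< (ℕ.<⇒≤ (scale-upper 18 n))) scale-≤ x<)
      where
      outcomes = cartesianProduct (permutations n) (allFin (length (samples s)))
      total : length outcomes ≡ n ! ℕ.* length (samples s)
      total = trans (length-cartesianProductWith _,_ (permutations n) (allFin (length (samples s))))
        (cong₂ ℕ._*_ (length-permutations n) (length-tabulate {n = length (samples s)} (λ i → i)))

-- For n = 0 there is no position to draw and the list of samples would be empty, whereas the number
-- of seeds must be positive.
trivial : ∀ r → Algorithm 0 r
trivial zero    = output Vec.[]
trivial (suc r) = round Vec.[] (λ _ → trivial r)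

partition : ∀ n → RandomizedAlgorithm n 4
partition zero    = record { seeds = 1 ; seeds-nonZero = _ ; run = λ _ → trivial 4 }
partition (suc n) = partitioner (suc n)

theorem8 : (ε : ℝ) → 0ℚ <ʳ ε → ε ʳ< (+ 1 / 18) →
    Σ ((n : ℕ) → RandomizedAlgorithm n 4) λ alg →
    QueryComplexityLinear alg ×
    (∃[ C ] ∃[ N ] 0ℚ < C ×
    ((c : ℝ) → 0ℚ ≤ʳ c → (n : ℕ) → N ℕ.≤ n →
    (1- exp⁻ (C · ((+ n / 1) ^ᶜ ε))) ≤ᶜ Pr[zeroError] c (alg n)))
theorem8 ε _ ε< = partition ,
  (4 ℕ.* factor , 0 , λ { zero _ π seed → z≤n ; (suc n) _ π seed → partitioner-queries (suc n) π seed }) ,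
  + 1 / 4 , 7 ℕ.^ 18 , ℚ.positive⁻¹ (+ 1 / 4) ,
  λ { c _ zero () ; c _ (suc n) large → partitioner-success (suc n) large c {ε} ε< }
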